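{- Any pre-geminal category $(\mathcal{B},\mathbb{C},F,\mathbb{H})$ induces code structures on any representable fibration over $\mathcal B$ and on the codomain fibration over $\mathcal{B}$.
   Context: Code structures. For a cloven fibration $p:\mathcal E\to\mathcal B$, $\mathcal E_A$ is the fiber over $A$ and $X\cdot f=f^*(X)$ is reindexing. A global element $a\in_1A$ is a morphism $1\to A$; $f(a)=f\circ a$ and $f(a,b)=f\circ\langle a,b\rangle$. For parallel $f,f':A\to B$ in $\mathcal B$, $f\approx f'$ means that the reindexing functors along $\langle\mathrm{id},f\rangle$ and $\langle\mathrm{id},f'\rangle:A\to A\times B$ are naturally isomorphic. If $\mathcal B$ has binary products and a chosen terminal object $1$, a code structure on $p$ consists of: (i) for each $A$ an object $\ulcorner\mathcal E_A\urcorner$ of $\mathcal B$ and for each $X\in\mathcal E_A$ a global element $\ulcorner X\urcorner\in_1\ulcorner\mathcal E_A\urcorner$; (ii) for each $A,B$ an object $\ulcorner\mathcal B(A,B)\urcorner$ of $\mathcal B$ and for each $f:A\to B$ a global element $\ulcorner f\urcorner\in_1\ulcorner\mathcal B(A,B)\urcorner$; (iii) for each $A,B$ a morphism $\mathsf{app}_{A,B}:\ulcorner\mathcal E_B\urcorner\times\ulcorner\mathcal B(A,B)\urcorner\to\ulcorner\mathcal E_A\urcorner$ with $\mathsf{app}_{A,B}(\ulcorner X\urcorner,\ulcorner f\urcorner)\approx\ulcorner X\cdot f\urcorner$ for all $X\in\mathcal E_B$, $f:A\to B$; (iv) for each $A$ a morphism $\mathsf{code}_A:\ulcorner\mathcal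 E_A\urcorner\to\ulcorner\mathcal B(1,\ulcorner\mathcal E_A\urcorner)\urcorner$ with $\mathsf{code}_A(\ulcorner X\urcorner)\approx\ulcorner\ulcorner X\urcorner\urcorner$ for all $X\in\mathcal E_A$. For $D\in\mathcal B$, the representable fibration $\mathrm{dom}_D:\mathcal B/D\to\mathcal B$ (domain functor from the slice) has fiber over $A$ the discrete category on $\mathcal B(A,D)$, with reindexing by precomposition. The codomain fibration $\mathrm{cod}_{\mathcal B}:\mathcal B^\to\to\mathcal B$ has fiber $\mathcal B/A$ over $A$, with reindexing by the chosen pullbacks of $\mathcal B$. Internal categories. Let $\mathcal B$ be a locally small category with finite limits (a terminal object $1$ and pullbacks). A $\mathcal B$-internal category $\mathbb C$ has an object of objects $|\mathbb C|$, an object of morphisms $|\mathbb C^{\to}|$, morphisms $\mathrm{dom},\mathrm{cod}:|\mathbb C^\to|\to|\mathbb C|$, an identity-assigning morphism and a composition morphism, satisfying the usual axioms. An internal functor $\mathbb H:\mathbb C\to\mathbb D$ is a pair $|\mathbb H|:|\mathbb C|\to|\mathbb D|$, $|\mathbb H^\to|:|\mathbb C^\to|\to|\mathbb D^\to|$ commuting with this structure. A global object $X\in_1\mathbb C$ is a morphism $X:1\to|\mathbb C|$; $\mathbb HX=|\mathbb H|\circ X$. The hom-object $\mathbb C(X,Y)$ is the pullback of $\langle\mathrm{dom},\mathrm{cod}\rangle:|\mathbb C^\to|\to|\mathbb C|\times|\mathbb C|$ along $\langle X,Y\rangle$; its global elements are identified with global elements of $|\mathbb C^\to|$ with domain $X$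 and codomain $Y$. The underlying category $\Gamma\mathbb C$ has global objects as objects and global elements of $\mathbb C(X,Y)$ as morphisms $X\to Y$; an internal functor $\mathbb H$ induces a functor $\Gamma\mathbb H$. $\mathbb C$ has chosen finite limits if it is equipped with an internal chosen terminal object $1_{\mathbb C}\in_1\mathbb C$ and internal chosen pullbacks (morphisms of $\mathcal B$ expressing a choice of pullback squares on the object of cospans and of mediating arrows, satisfying the evident internal equations); then $\Gamma\mathbb C$ has induced chosen finite limits. The global section functor is $\gamma_{\mathbb C}=\mathbb C(1_{\mathbb C},-):\Gamma\mathbb C\to\mathcal B$ (acting on morphisms by composition in $\mathbb C$); it preserves finite limits. If $G:\mathcal B\to\mathcal B'$ preserves finite limits, $G\mathbb C$ is the $\mathcal B'$-internal category obtained by applying $G$ to all data of $\mathbb C$, and $G^{\#}_{\mathbb C}:\Gamma\mathbb C\to\Gamma G\mathbb C$ is the functor sending a global object $X$ to $1\cong G1\xrightarrow{GX}G|\mathbb C|$, and likewise on global morphisms. Pre-geminal category. It consists of: (I) a category $\mathcal B$ with chosen finite limits; (II) a $\mathcal B$-internal category $\mathbb C$ with chosen finite limits; (III) a functor $F:\mathcal B\to\Gamma\mathbb C$ strictly preserving the chosen finite limits; put $\Box=\gamma_{\mathbb C}\circ F:\mathcal B\to\mathcal B$, which preserves finite limits; (IV) a $\mathcal B$-internal functor $\mathbb H:\mathbb C\to\Box\mathbb C$ satisfying $\Gamma\mathbb H\circ F=F^{\#}_{\mathbb C}\circ F$, where the codomain $\Gamma F\mathbb C$ of $F^{\#}_{\mathbb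 C}$ is identified with $\Gamma\Box\mathbb C=\Gamma\gamma_{\mathbb C}F\mathbb C$ by the canonical isomorphism. -}

module Defs where

open import Level using (Level; _⊔_) renaming (suc to lsuc)
open import Data.Product using (_,_; _×_; Σ-syntax)
open import Relation.Binary.PropositionalEquality using (_≡_; refl; sym; cong)
  renaming (trans to infixr 5 _∙_)
open import Relation.Binary.PropositionalEquality.WithK using ()
  renaming (≡-irrelevant to uip)

private
  variable
    o ℓ o′ ℓ′ o″ ℓ″ : Level

------------------------------------------------------------------------
-- Morphisms are compared by _≡_.  By axiom K every type is a set, so this is
-- the usual notion of locally small category, and strict equality of objects
-- and of functors makes sense.

record Category (o ℓ : Level) : Set (lsuc (o ⊔ ℓ)) where
  infixr 9 _∘_
  field
    Obj       : Set o
    Hom       : Obj → Obj → Set ℓ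
    id        : ∀ {A} → Hom A A
    _∘_       : ∀ {A B C} → Hom B C → Hom A B → Hom A C
    identityˡ : ∀ {A B} (f : Hom A B) → id ∘ f ≡ f
    identityʳ : ∀ {A B} (f : Hom A B) → f ∘ id ≡ f
    assoc     : ∀ {A B C D} (h : Hom C D) (g : Hom B C) (f : Hom A B) →
                (h ∘ g) ∘ f ≡ h ∘ (g ∘ f)

  -- The identity morphism, typed along an equality of objects.
  coe : ∀ {A B} → A ≡ B → Hom A B
  coe refl = id

  infixl 8 _⟩∘_
  infixr 8 _∘⟨_

  _⟩∘_ : ∀ {A B C} {g g′ : Hom B C} → g ≡ g′ → (f : Hom A B) → g ∘ f ≡ g′ ∘ f
  p ⟩∘ f = cong (_∘ f) p

  _∘⟨_ : ∀ {A B C} (g : Hom B C) {f f′ : Hom A B} → f ≡ f′ → g ∘ f ≡ g ∘ f′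
  g ∘⟨ p = cong (g ∘_) p

record Functor (𝒞 : Category o ℓ) (𝒟 : Category o′ ℓ′) : Set (o ⊔ ℓ ⊔ o′ ⊔ ℓ′) where
  private
    module C = Category 𝒞
    module D = Category 𝒟
  field
    F₀           : C.Obj → D.Obj
    F₁           : ∀ {A B} → C.Hom A B → D.Hom (F₀ A) (F₀ B)
    identity     : ∀ {A} → F₁ (C.id {A}) ≡ D.id
    homomorphism : ∀ {X Y Z} (g : C.Hom Y Z) (f : C.Hom X Y) →
                   F₁ (g C.∘ f) ≡ F₁ g D.∘ F₁ f

infixr 9 _∘F_
_∘F_ : {𝒞 : Category o ℓ} {𝒟 : Category o′ ℓ′} {ℰ : Category o″ ℓ″} →
       Functor 𝒟 ℰ → Functor 𝒞 𝒟 → Functor 𝒞 ℰ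
G ∘F F = record
  { F₀           = λ A → G.F₀ (F.F₀ A)
  ; F₁           = λ f → G.F₁ (F.F₁ f)
  ; identity     = cong G.F₁ F.identity ∙ G.identity
  ; homomorphism = λ g f → cong G.F₁ (F.homomorphism g f) ∙ G.homomorphism _ _
  }
  where
    module F = Functor F
    module G = Functor G

infix 4 _≡F_
record _≡F_ {𝒞 : Category o ℓ} {𝒟 : Category o′ ℓ′} (F G : Functor 𝒞 𝒟)
       : Set (o ⊔ ℓ ⊔ o′ ⊔ ℓ′) where
  private
    module C = Category 𝒞
    module F = Functor F
    module G = Functor G
  open Category 𝒟
  field
    eq₀ : ∀ A → F.F₀ A ≡ G.F₀ A
    eq₁ : ∀ {A B} (f : C.Hom A B) → coe (eq₀ B) ∘ F.F₁ f ≡ G.F₁ f ∘ coe (eq₀ A)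

record NaturalIsomorphism {𝒞 : Category o ℓ} {𝒟 : Category o′ ℓ′} (F G : Functor 𝒞 𝒟)
       : Set (o ⊔ ℓ ⊔ o′ ⊔ ℓ′) where
  private
    module C = Category 𝒞
    module F = Functor F
    module G = Functor G
  open Category 𝒟
  field
    η       : ∀ A → Hom (F.F₀ A) (G.F₀ A)
    η⁻¹     : ∀ A → Hom (G.F₀ A) (F.F₀ A)
    isoˡ    : ∀ A → η⁻¹ A ∘ η A ≡ id
    isoʳ    : ∀ A → η A ∘ η⁻¹ A ≡ id
    natural : ∀ {A B} (f : C.Hom A B) → η B ∘ F.F₁ f ≡ G.F₁ f ∘ η A

------------------------------------------------------------------------

module _ (ℬ : Category o ℓ) where
  open Category ℬ

  record IsTerminal (⊤ : Obj) : Set (o ⊔ ℓ) where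
    field
      !        : ∀ {A} → Hom A ⊤
      !-unique : ∀ {A} (f g : Hom A ⊤) → f ≡ g

  record Terminal : Set (o ⊔ ℓ) where
    field
      ⊤          : Obj
      isTerminal : IsTerminal ⊤
    open IsTerminal isTerminal public

  record IsPullback {P X Y Z : Obj} (p₁ : Hom P X) (p₂ : Hom P Y)
                    (f : Hom X Z) (g : Hom Y Z) : Set (o ⊔ ℓ) where
    field
      commute      : f ∘ p₁ ≡ g ∘ p₂
      universal    : ∀ {T} (h : Hom T X) (k : Hom T Y) → f ∘ h ≡ g ∘ k → Hom T P
      p₁∘universal : ∀ {T} (h : Hom T X) (k : Hom T Y) (e : f ∘ h ≡ g ∘ k) →
                     p₁ ∘ universal h k e ≡ h
      p₂∘universal : ∀ {T} (h : Hom T X) (k : Hom T Y) (e : f ∘ h ≡ g ∘ k) →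
                     p₂ ∘ universal h k e ≡ k
      unique       : ∀ {T} (u v : Hom T P) → p₁ ∘ u ≡ p₁ ∘ v → p₂ ∘ u ≡ p₂ ∘ v → u ≡ v

  record Pullback {X Y Z : Obj} (f : Hom X Z) (g : Hom Y Z) : Set (o ⊔ ℓ) where
    field
      P          : Obj
      p₁         : Hom P X
      p₂         : Hom P Y
      isPullback : IsPullback p₁ p₂ f g
    open IsPullback isPullback public

  record Product (A B : Obj) : Set (o ⊔ ℓ) where
    field
      A×B    : Obj
      π₁     : Hom A×B A
      π₂     : Hom A×B B
      ⟨_,_⟩  : ∀ {T} → Hom T A → Hom T B → Hom T A×B
      π₁∘⟨⟩  : ∀ {T} (f : Hom T A) (g : Hom T B) → π₁ ∘ ⟨ f , g ⟩ ≡ f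
      π₂∘⟨⟩  : ∀ {T} (f : Hom T A) (g : Hom T B) → π₂ ∘ ⟨ f , g ⟩ ≡ g
      unique : ∀ {T} (u v : Hom T A×B) → π₁ ∘ u ≡ π₁ ∘ v → π₂ ∘ u ≡ π₂ ∘ v → u ≡ v

  BinaryProducts : Set (o ⊔ ℓ)
  BinaryProducts = ∀ A B → Product A B

  record FiniteLimits : Set (o ⊔ ℓ) where
    field
      terminal : Terminal
      pullback : ∀ {X Y Z} (f : Hom X Z) (g : Hom Y Z) → Pullback f g
    open Terminal terminal public

    products : BinaryProducts
    products A B = record
      { A×B    = P
      ; π₁     = p₁
      ; π₂     = p₂
      ; ⟨_,_⟩  = λ f g → universal f g (!-unique _ _)
      ; π₁∘⟨⟩  = λ f g → p₁∘universal f g _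
      ; π₂∘⟨⟩  = λ f g → p₂∘universal f g _
      ; unique = unique
      }
      where open Pullback (pullback (! {A}) (! {B}))

module _ {𝒞 : Category o ℓ} {𝒟 : Category o′ ℓ′}
         (L : FiniteLimits 𝒞) (G : Functor 𝒞 𝒟) where
  private
    module C = Category 𝒞
    module D = Category 𝒟
    module L = FiniteLimits L
  open Functor G

  -- Limits being unique up to isomorphism, it suffices to ask this of the
  -- chosen limits of 𝒞.
  record PreservesFiniteLimits : Set (o ⊔ ℓ ⊔ o′ ⊔ ℓ′) where
    field
      preserves-⊤  : IsTerminal 𝒟 (F₀ L.⊤)
      preserves-pb : ∀ {X Y Z} (f : C.Hom X Z) (g : C.Hom Y Z) →
                     let module Q = Pullback (L.pullback f g) in
                     IsPullback 𝒟 (F₁ Q.p₁) (F₁ Q.p₂) (F₁ f) (F₁ g)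

  record StrictlyPreservesFiniteLimits (L′ : FiniteLimits 𝒟) : Set (o ⊔ ℓ ⊔ o′ ⊔ ℓ′) where
    private module L′ = FiniteLimits L′
    field
      strict-⊤  : F₀ L.⊤ ≡ L′.⊤
      strict-pb : ∀ {X Y Z} (f : C.Hom X Z) (g : C.Hom Y Z) →
                  let module Q  = Pullback (L.pullback f g)
                      module Q′ = Pullback (L′.pullback (F₁ f) (F₁ g)) in
                  Σ[ e ∈ F₀ Q.P ≡ Q′.P ]
                    (F₁ Q.p₁ ≡ Q′.p₁ D.∘ D.coe e) × (F₁ Q.p₂ ≡ Q′.p₂ D.∘ D.coe e)

module _ {𝒟 : Category o ℓ} where
  open Category 𝒟

  isPullback-coe : ∀ {P Q X Y Z} {f : Hom X Z} {g : Hom Y Z} {p₁ : Hom P X} {p₂ : Hom P Y}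
                   {q₁ : Hom Q X} {q₂ : Hom Q Y} (e : Q ≡ P) →
                   q₁ ≡ p₁ ∘ coe e → q₂ ≡ p₂ ∘ coe e →
                   IsPullback 𝒟 p₁ p₂ f g → IsPullback 𝒟 q₁ q₂ f g
  isPullback-coe {p₁ = p₁} {p₂} refl e₁ e₂ pb
    with refl ← e₁ ∙ identityʳ p₁ | refl ← e₂ ∙ identityʳ p₂ = pb

strict⇒preserves : {𝒞 : Category o ℓ} {𝒟 : Category o′ ℓ′}
                   {L : FiniteLimits 𝒞} {L′ : FiniteLimits 𝒟} {G : Functor 𝒞 𝒟} →
                   StrictlyPreservesFiniteLimits L G L′ → PreservesFiniteLimits L G
strict⇒preserves {𝒟 = 𝒟} {L = L} {L′} {G} s = record
  { preserves-⊤  = terminal-≡ strict-⊤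
  ; preserves-pb = λ f g → let e , e₁ , e₂ = strict-pb f g in
      isPullback-coe {𝒟 = 𝒟} e e₁ e₂ (Pullback.isPullback (FiniteLimits.pullback L′ _ _))
  }
  where
    open StrictlyPreservesFiniteLimits s
    terminal-≡ : ∀ {A} → A ≡ FiniteLimits.⊤ L′ → IsTerminal 𝒟 A
    terminal-≡ refl = FiniteLimits.isTerminal L′

∘-preserves : {𝒞 : Category o ℓ} {𝒟 : Category o′ ℓ′} {ℰ : Category o″ ℓ″}
              {L : FiniteLimits 𝒞} {L′ : FiniteLimits 𝒟}
              {G : Functor 𝒟 ℰ} {F : Functor 𝒞 𝒟} →
              PreservesFiniteLimits L′ G → StrictlyPreservesFiniteLimits L F L′ →
              PreservesFiniteLimits L (G ∘F F)
∘-preserves {𝒟 = 𝒟} {ℰ = ℰ} {L = L} {L′} {G} {F} pG sF = record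
  { preserves-⊤  = terminal-≡ strict-⊤
  ; preserves-pb = λ f g → let e , e₁ , e₂ = strict-pb f g in
      isPullback-coe {𝒟 = ℰ} (cong G.F₀ e)
        (cong G.F₁ e₁ ∙ G.homomorphism _ _ ∙ (_ E.∘⟨ G-coe e))
        (cong G.F₁ e₂ ∙ G.homomorphism _ _ ∙ (_ E.∘⟨ G-coe e))
        (preserves-pb (Functor.F₁ F f) (Functor.F₁ F g))
  }
  where
    module D = Category 𝒟
    module E = Category ℰ
    module G = Functor G
    open PreservesFiniteLimits pG
    open StrictlyPreservesFiniteLimits sF
    terminal-≡ : ∀ {A} → A ≡ FiniteLimits.⊤ L′ → IsTerminal ℰ (G.F₀ A)
    terminal-≡ refl = preserves-⊤
    G-coe : ∀ {A B} (e : A ≡ B) → G.F₁ (D.coe e) ≡ E.coe (cong G.F₀ e)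
    G-coe refl = G.identity

------------------------------------------------------------------------

module _ {ℰ : Category o ℓ} {ℬ : Category o′ ℓ′} (p : Functor ℰ ℬ) where
  private
    module E = Category ℰ
    module B = Category ℬ
    open Functor p using () renaming (F₀ to p₀; F₁ to p₁)

  record FibreObj (A : B.Obj) : Set (o ⊔ o′) where
    constructor _over_
    field
      obj  : E.Obj
      base : p₀ obj ≡ A
  open FibreObj

  -- Equivalently p₁ φ ≡ f, up to the equalities of objects `base`.
  infix 4 _LiesOver_
  _LiesOver_ : ∀ {A B} {X : FibreObj A} {Y : FibreObj B} →
               E.Hom (obj X) (obj Y) → B.Hom A B → Set ℓ′
  _LiesOver_ {X = X} {Y} φ f = B.coe (base Y) B.∘ p₁ φ ≡ f B.∘ B.coe (base X)

  record Vertical {A : B.Obj} (X Y : FibreObj A) : Set (ℓ ⊔ ℓ′) where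
    constructor vertical
    field
      arr   : E.Hom (obj X) (obj Y)
      above : _LiesOver_ {X = X} {Y} arr B.id
  open Vertical

  vertical-≡ : ∀ {A} {X Y : FibreObj A} {u v : Vertical X Y} → arr u ≡ arr v → u ≡ v
  vertical-≡ {u = vertical a e} {vertical .a e′} refl = cong (vertical a) (uip e e′)

  private
    infixr 9 _∘ⱽ_
    _∘ⱽ_ : ∀ {A} {X Y Z : FibreObj A} → Vertical Y Z → Vertical X Y → Vertical X Z
    _∘ⱽ_ {X = X} {Y} {Z} u v = vertical (arr u E.∘ arr v)
      ( (_ B.∘⟨ Functor.homomorphism p (arr u) (arr v))
      ∙ sym (B.assoc _ _ _)
      ∙ ((above u ∙ B.identityˡ _) B.⟩∘ _)
      ∙ above v )

  Fibre : B.Obj → Category (o ⊔ o′) (ℓ ⊔ ℓ′)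
  Fibre A = record
    { Obj       = FibreObj A
    ; Hom       = Vertical
    ; id        = vertical E.id
        ((_ B.∘⟨ Functor.identity p) ∙ B.identityʳ _ ∙ sym (B.identityˡ _))
    ; _∘_       = _∘ⱽ_
    ; identityˡ = λ f → vertical-≡ (E.identityˡ (arr f))
    ; identityʳ = λ f → vertical-≡ (E.identityʳ (arr f))
    ; assoc     = λ h g f → vertical-≡ (E.assoc (arr h) (arr g) (arr f))
    }

  record CartesianLift {A B : B.Obj} (f : B.Hom A B) (Y : FibreObj B)
         : Set (o ⊔ ℓ ⊔ o′ ⊔ ℓ′) where
    field
      source        : FibreObj A
      lift          : E.Hom (obj source) (obj Y)
      lift-over     : _LiesOver_ {X = source} {Y} lift f
      factor        : ∀ {Z : E.Obj} (g : B.Hom (p₀ Z) A) (h : E.Hom Z (obj Y)) →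
                      B.coe (base Y) B.∘ p₁ h ≡ f B.∘ g → E.Hom Z (obj source)
      factor-over   : ∀ {Z} (g : B.Hom (p₀ Z) A) (h : E.Hom Z (obj Y))
                      (e : B.coe (base Y) B.∘ p₁ h ≡ f B.∘ g) →
                      B.coe (base source) B.∘ p₁ (factor g h e) ≡ g
      lift∘factor   : ∀ {Z} (g : B.Hom (p₀ Z) A) (h : E.Hom Z (obj Y))
                      (e : B.coe (base Y) B.∘ p₁ h ≡ f B.∘ g) →
                      lift E.∘ factor g h e ≡ h
      factor-unique : ∀ {Z} (u v : E.Hom Z (obj source)) →
                      B.coe (base source) B.∘ p₁ u ≡ B.coe (base source) B.∘ p₁ v →
                      lift E.∘ u ≡ lift E.∘ v → u ≡ v

record ClovenFibration (o ℓ : Level) (ℬ : Category o′ ℓ′)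
       : Set (lsuc (o ⊔ ℓ) ⊔ o′ ⊔ ℓ′) where
  private module B = Category ℬ
  field
    total    : Category o ℓ
    proj     : Functor total ℬ
    cleavage : ∀ {A B} (f : B.Hom A B) (Y : FibreObj proj B) → CartesianLift proj f Y

  private
    module E = Category total
    module p = Functor proj
  open FibreObj
  open Vertical

  Fib : B.Obj → Category (o ⊔ o′) (ℓ ⊔ ℓ′)
  Fib = Fibre proj

  infixl 8 _·_
  _·_ : ∀ {A B} → FibreObj proj B → B.Hom A B → FibreObj proj A
  Y · f = CartesianLift.source (cleavage f Y)

  reindex : ∀ {A B} → B.Hom A B → Functor (Fib B) (Fib A)
  reindex {A} {B} f = record
    { F₀           = _· f
    ; F₁           = λ v → vertical (mor v) (mor-over v ∙ sym (B.identityˡ _))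
    ; identity     = λ {Y} → vertical-≡ proj
        (Lift.factor-unique Y _ _
          (mor-over (Category.id (Fib B)) ∙ sym (B.identityʳ _) ∙ sym (B._∘⟨_ _ p.identity))
          (lift∘mor (Category.id (Fib B)) ∙ E.identityˡ _ ∙ sym (E.identityʳ _)))
    ; homomorphism = λ {X} {Y} {Z} v u → vertical-≡ proj
        (Lift.factor-unique Z _ _
          ( mor-over (Category._∘_ (Fib B) v u)
          ∙ sym (mor-over u)
          ∙ (sym (mor-over v) B.⟩∘ _)
          ∙ B.assoc _ _ _
          ∙ (_ B.∘⟨ sym (p.homomorphism _ _)) )
          ( lift∘mor (Category._∘_ (Fib B) v u)
          ∙ E.assoc _ _ _
          ∙ (_ E.∘⟨ sym (lift∘mor u))
          ∙ sym (E.assoc _ _ _)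
          ∙ (sym (lift∘mor v) E.⟩∘ _)
          ∙ E.assoc _ _ _ ))
    }
    where
      module Lift (Y : FibreObj proj B) = CartesianLift (cleavage f Y)

      mor-cond : ∀ {X Y : FibreObj proj B} (v : Vertical proj X Y) →
                 B.coe (base Y) B.∘ p.F₁ (arr v E.∘ Lift.lift X) ≡ f B.∘ B.coe (base (X · f))
      mor-cond {X} v =
          (_ B.∘⟨ p.homomorphism _ _)
        ∙ sym (B.assoc _ _ _)
        ∙ ((above v ∙ B.identityˡ _) B.⟩∘ _)
        ∙ Lift.lift-over X

      mor : ∀ {X Y : FibreObj proj B} → Vertical proj X Y → E.Hom (obj (X · f)) (obj (Y · f))
      mor {X} {Y} v = Lift.factor Y (B.coe (base (X · f))) (arr v E.∘ Lift.lift X) (mor-cond v)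

      mor-over : ∀ {X Y : FibreObj proj B} (v : Vertical proj X Y) →
                 B.coe (base (Y · f)) B.∘ p.F₁ (mor v) ≡ B.coe (base (X · f))
      mor-over {Y = Y} v = Lift.factor-over Y _ _ (mor-cond v)

      lift∘mor : ∀ {X Y : FibreObj proj B} (v : Vertical proj X Y) →
                 Lift.lift Y E.∘ mor v ≡ arr v E.∘ Lift.lift X
      lift∘mor {Y = Y} v = Lift.lift∘factor Y _ _ (mor-cond v)

module _ (ℬ : Category o ℓ) where
  open Category ℬ

  record SliceObj (D : Obj) : Set (o ⊔ ℓ) where
    constructor slice
    field
      {source} : Obj
      to       : Hom source D

  record SliceHom {D : Obj} (X Y : SliceObj D) : Set ℓ where
    constructor slicehom
    private
      module X = SliceObj X
      module Y = SliceObj Y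
    field
      arr      : Hom X.source Y.source
      triangle : Y.to ∘ arr ≡ X.to

  sliceHom-≡ : ∀ {D} {X Y : SliceObj D} {u v : SliceHom X Y} →
               SliceHom.arr u ≡ SliceHom.arr v → u ≡ v
  sliceHom-≡ {u = slicehom a e} {slicehom .a e′} refl = cong (slicehom a) (uip e e′)

  Slice : Obj → Category (o ⊔ ℓ) ℓ
  Slice D = record
    { Obj       = SliceObj D
    ; Hom       = SliceHom
    ; id        = slicehom id (identityʳ _)
    ; _∘_       = λ { (slicehom g e) (slicehom f e′) →
                      slicehom (g ∘ f) (sym (assoc _ _ _) ∙ (e ⟩∘ f) ∙ e′) }
    ; identityˡ = λ f → sliceHom-≡ (identityˡ _)
    ; identityʳ = λ f → sliceHom-≡ (identityʳ _)
    ; assoc     = λ h g f → sliceHom-≡ (assoc _ _ _)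
    }

  record ArrowObj : Set (o ⊔ ℓ) where
    constructor arrow
    field
      {source target} : Obj
      to              : Hom source target

  record ArrowHom (X Y : ArrowObj) : Set ℓ where
    constructor square
    private
      module X = ArrowObj X
      module Y = ArrowObj Y
    field
      top     : Hom X.source Y.source
      bottom  : Hom X.target Y.target
      commute : Y.to ∘ top ≡ bottom ∘ X.to

  arrowHom-≡ : ∀ {X Y : ArrowObj} {u v : ArrowHom X Y} → ArrowHom.top u ≡ ArrowHom.top v →
               ArrowHom.bottom u ≡ ArrowHom.bottom v → u ≡ v
  arrowHom-≡ {u = square a b e} {square .a .b e′} refl refl = cong (square a b) (uip e e′)

  Arrow : Category (o ⊔ ℓ) ℓ
  Arrow = record
    { Obj       = ArrowObj
    ; Hom       = ArrowHom
    ; id        = square id id (identityʳ _ ∙ sym (identityˡ _))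
    ; _∘_       = λ { (square g g′ e) (square f f′ e′) →
                      square (g ∘ f) (g′ ∘ f′)
                        ( sym (assoc _ _ _) ∙ (e ⟩∘ f) ∙ assoc _ _ _
                        ∙ (g′ ∘⟨ e′) ∙ sym (assoc _ _ _)) }
    ; identityˡ = λ f → arrowHom-≡ (identityˡ _) (identityˡ _)
    ; identityʳ = λ f → arrowHom-≡ (identityʳ _) (identityʳ _)
    ; assoc     = λ h g f → arrowHom-≡ (assoc _ _ _) (assoc _ _ _)
    }

  dom-fibration : Obj → ClovenFibration (o ⊔ ℓ) ℓ ℬ
  dom-fibration D = record
    { total    = Slice D
    ; proj     = domain
    ; cleavage = λ f Y → lift f Y
    }
    where
      domain : Functor (Slice D) ℬ
      domain = record
        { F₀           = SliceObj.source
        ; F₁           = SliceHom.arr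
        ; identity     = refl
        ; homomorphism = λ _ _ → refl
        }

      lift : ∀ {A B} (f : Hom A B) (Y : FibreObj domain B) → CartesianLift domain f Y
      lift f (slice y over refl) = record
        { source        = slice (y ∘ f) over refl
        ; lift          = slicehom f refl
        ; lift-over     = identityˡ _ ∙ sym (identityʳ _)
        ; factor        = λ { g (slicehom h e′) e → slicehom g
                              (assoc _ _ _ ∙ (y ∘⟨ (sym e ∙ identityˡ _)) ∙ e′) }
        ; factor-over   = λ g h e → identityˡ _
        ; lift∘factor   = λ g h e → sliceHom-≡ (sym e ∙ identityˡ _)
        ; factor-unique = λ u v e _ → sliceHom-≡ (sym (identityˡ _) ∙ e ∙ identityˡ _)
        }

  cod-fibration : FiniteLimits ℬ → ClovenFibration (o ⊔ ℓ) ℓ ℬ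
  cod-fibration L = record
    { total    = Arrow
    ; proj     = codomain
    ; cleavage = λ f Y → lift f Y
    }
    where
      codomain : Functor Arrow ℬ
      codomain = record
        { F₀           = ArrowObj.target
        ; F₁           = ArrowHom.bottom
        ; identity     = refl
        ; homomorphism = λ _ _ → refl
        }

      lift : ∀ {A B} (f : Hom A B) (Y : FibreObj codomain B) → CartesianLift codomain f Y
      lift f (arrow y over refl) = record
        { source        = arrow p₁ over refl
        ; lift          = square p₂ f (sym commute)
        ; lift-over     = identityˡ _ ∙ sym (identityʳ _)
        ; factor        = λ g h e → square (fac g h e) g (p₁∘universal _ _ (fac-cond g h e))
        ; factor-over   = λ g h e → identityˡ _
        ; lift∘factor   = λ g h e → arrowHom-≡ (p₂∘universal _ _ (fac-cond g h e))
                                               (sym e ∙ identityˡ _)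
        ; factor-unique = λ u v e e′ →
            let b = sym (identityˡ _) ∙ e ∙ identityˡ _ in
            arrowHom-≡
              (unique _ _ (ArrowHom.commute u ∙ (b ⟩∘ _) ∙ sym (ArrowHom.commute v))
                          (cong ArrowHom.top e′))
              b
        }
        where
          open Pullback (FiniteLimits.pullback L f y)

          fac-cond : ∀ {Z : ArrowObj} (g : Hom (ArrowObj.target Z) _) (h : ArrowHom Z (arrow y)) →
                     id ∘ ArrowHom.bottom h ≡ f ∘ g →
                     f ∘ (g ∘ ArrowObj.to Z) ≡ y ∘ ArrowHom.top h
          fac-cond g h e =
              sym (assoc _ _ _)
            ∙ ((sym e ∙ identityˡ _) ⟩∘ _)
            ∙ sym (ArrowHom.commute h)

          fac : ∀ {Z : ArrowObj} (g : Hom (ArrowObj.target Z) _) (h : ArrowHom Z (arrow y)) →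
                id ∘ ArrowHom.bottom h ≡ f ∘ g → Hom (ArrowObj.source Z) P
          fac g h e = universal _ _ (fac-cond g h e)

------------------------------------------------------------------------

module CodeStructures {ℬ : Category o ℓ} (𝟙 : Terminal ℬ) (products : BinaryProducts ℬ)
                      (p : ClovenFibration o′ ℓ′ ℬ) where
  open Category ℬ
  open Terminal 𝟙
  open ClovenFibration p
  private module × {A B} = Product (products A B)

  infixr 6 _⊗_
  _⊗_ : Obj → Obj → Obj
  A ⊗ B = Product.A×B (products A B)

  infix 4 _≈_
  record _≈_ {A B : Obj} (f f′ : Hom A B) : Set (o ⊔ o′ ⊔ ℓ ⊔ ℓ′) where
    constructor reindexings-isomorphic
    field
      iso : NaturalIsomorphism (reindex ×.⟨ id , f ⟩) (reindex ×.⟨ id , f′ ⟩)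

  record Codes : Set (o ⊔ ℓ ⊔ o′ ⊔ ℓ′) where
    field
      ⌜E_⌝   : Obj → Obj
      ⌜_⌝ᴱ   : ∀ {A} → FibreObj proj A → Hom ⊤ ⌜E A ⌝
      ⌜B_,_⌝ : Obj → Obj → Obj
      ⌜_⌝ᴮ   : ∀ {A B} → Hom A B → Hom ⊤ ⌜B A , B ⌝

  record CodeStructure : Set (o ⊔ ℓ ⊔ o′ ⊔ ℓ′) where
    field
      codes : Codes
    open Codes codes public
    field
      app    : ∀ A B → Hom (⌜E B ⌝ ⊗ ⌜B A , B ⌝) ⌜E A ⌝
      app-≈  : ∀ {A B} (X : FibreObj proj B) (f : Hom A B) →
               app A B ∘ ×.⟨ ⌜ X ⌝ᴱ , ⌜ f ⌝ᴮ ⟩ ≈ ⌜ X · f ⌝ᴱ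
      code   : ∀ A → Hom ⌜E A ⌝ ⌜B ⊤ , ⌜E A ⌝ ⌝
      code-≈ : ∀ {A} (X : FibreObj proj A) → code A ∘ ⌜ X ⌝ᴱ ≈ ⌜ ⌜ X ⌝ᴱ ⌝ᴮ

open CodeStructures public using (Codes; CodeStructure)

------------------------------------------------------------------------

module _ {ℬ : Category o ℓ} (L : FiniteLimits ℬ) where
  open Category ℬ
  open FiniteLimits L

  record InternalCategory : Set (o ⊔ ℓ) where
    field
      C₀ C₁   : Obj
      dom cod : Hom C₁ C₀
      ident   : Hom C₀ C₁

    -- Composable pairs (g , f) with dom g = cod f.
    module Pairs = Pullback (pullback dom cod)
    C₂ : Obj
    C₂ = Pairs.P

    field
      comp : Hom C₂ C₁

    compose : ∀ {T} (g f : Hom T C₁) → dom ∘ g ≡ cod ∘ f → Hom T C₁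
    compose g f p = comp ∘ Pairs.universal g f p

    field
      dom-ident : dom ∘ ident ≡ id
      cod-ident : cod ∘ ident ≡ id
      dom-comp  : dom ∘ comp ≡ dom ∘ Pairs.p₂
      cod-comp  : cod ∘ comp ≡ cod ∘ Pairs.p₁
      -- Generalized elements express these as equations on the object of
      -- composable triples (resp. on C₁), by taking the universal instance.
      compose-identˡ : ∀ {T} (f : Hom T C₁) (p : dom ∘ (ident ∘ (cod ∘ f)) ≡ cod ∘ f) →
                       compose (ident ∘ (cod ∘ f)) f p ≡ f
      compose-identʳ : ∀ {T} (f : Hom T C₁) (p : dom ∘ f ≡ cod ∘ (ident ∘ (dom ∘ f))) →
                       compose f (ident ∘ (dom ∘ f)) p ≡ f
      compose-assoc  : ∀ {T} (h g f : Hom T C₁) (p : dom ∘ h ≡ cod ∘ g) (q : dom ∘ g ≡ cod ∘ f)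
                       (r : dom ∘ compose h g p ≡ cod ∘ f) (s : dom ∘ h ≡ cod ∘ compose g f q) →
                       compose (compose h g p) f r ≡ compose h (compose g f q) s

  module Internal (ℂ : InternalCategory) where
    open InternalCategory ℂ public

    abstract
      compose-cong : ∀ {T} {g g′ f f′ : Hom T C₁} {p p′} → g ≡ g′ → f ≡ f′ →
                     compose g f p ≡ compose g′ f′ p′
      compose-cong {p = p} {p′} refl refl = cong (compose _ _) (uip p p′)

    private
      abstract
        cond-∘ : ∀ {S T} {g f : Hom T C₁} → dom ∘ g ≡ cod ∘ f → (t : Hom S T) →
                 dom ∘ (g ∘ t) ≡ cod ∘ (f ∘ t)
        cond-∘ p t = sym (assoc _ _ _) ∙ (p ⟩∘ t) ∙ assoc _ _ _

    abstract
      compose-∘ : ∀ {S T} {g f : Hom T C₁} {p : dom ∘ g ≡ cod ∘ f} (t : Hom S T) {p′} →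
                  compose g f p ∘ t ≡ compose (g ∘ t) (f ∘ t) p′
      compose-∘ {p = p} t {p′} = assoc _ _ _ ∙ (comp ∘⟨ Pairs.unique _ _
        ( sym (assoc _ _ _) ∙ (Pairs.p₁∘universal _ _ p ⟩∘ t) ∙ sym (Pairs.p₁∘universal _ _ p′))
        ( sym (assoc _ _ _) ∙ (Pairs.p₂∘universal _ _ p ⟩∘ t) ∙ sym (Pairs.p₂∘universal _ _ p′)))

    abstract
      dom-compose : ∀ {T} {g f : Hom T C₁} {p : dom ∘ g ≡ cod ∘ f} → dom ∘ compose g f p ≡ dom ∘ f
      dom-compose {p = p} =
        sym (assoc _ _ _) ∙ (dom-comp ⟩∘ _) ∙ assoc _ _ _ ∙ (dom ∘⟨ Pairs.p₂∘universal _ _ p)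

    abstract
      cod-compose : ∀ {T} {g f : Hom T C₁} {p : dom ∘ g ≡ cod ∘ f} → cod ∘ compose g f p ≡ cod ∘ g
      cod-compose {p = p} =
        sym (assoc _ _ _) ∙ (cod-comp ⟩∘ _) ∙ assoc _ _ _ ∙ (cod ∘⟨ Pairs.p₁∘universal _ _ p)

    module ⟨dom,cod⟩ = Product (products C₀ C₀)

    homPullback : (X Y : Hom ⊤ C₀) →
      Pullback ℬ (Product.⟨_,_⟩ (products C₀ C₀) dom cod) (Product.⟨_,_⟩ (products C₀ C₀) X Y)
    homPullback X Y = pullback _ _

    module HomObj (X Y : Hom ⊤ C₀) where
      open Pullback (homPullback X Y) public
        renaming (P to object; p₁ to incl)

      abstract
        incl-mono : ∀ {T} (u v : Hom T object) → incl ∘ u ≡ incl ∘ v → u ≡ v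
        incl-mono u v e = unique u v e (!-unique _ _)

      abstract
        dom-incl : dom ∘ incl ≡ X ∘ !
        dom-incl =
            (sym (⟨dom,cod⟩.π₁∘⟨⟩ dom cod) ⟩∘ _) ∙ assoc _ _ _ ∙ (_ ∘⟨ commute)
          ∙ sym (assoc _ _ _) ∙ (⟨dom,cod⟩.π₁∘⟨⟩ X Y ⟩∘ _) ∙ (X ∘⟨ !-unique _ _)

      abstract
        cod-incl : cod ∘ incl ≡ Y ∘ !
        cod-incl =
            (sym (⟨dom,cod⟩.π₂∘⟨⟩ dom cod) ⟩∘ _) ∙ assoc _ _ _ ∙ (_ ∘⟨ commute)
          ∙ sym (assoc _ _ _) ∙ (⟨dom,cod⟩.π₂∘⟨⟩ X Y ⟩∘ _) ∙ (Y ∘⟨ !-unique _ _)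

      private
        abstract
          cond : ∀ {T} (f : Hom T C₁) → dom ∘ f ≡ X ∘ ! → cod ∘ f ≡ Y ∘ ! →
                 ⟨dom,cod⟩.⟨ dom , cod ⟩ ∘ f ≡ ⟨dom,cod⟩.⟨ X , Y ⟩ ∘ !
          cond f d c = ⟨dom,cod⟩.unique _ _
            ( sym (assoc _ _ _) ∙ (⟨dom,cod⟩.π₁∘⟨⟩ dom cod ⟩∘ f) ∙ d
            ∙ (sym (⟨dom,cod⟩.π₁∘⟨⟩ X Y) ⟩∘ !) ∙ assoc _ _ _ )
            ( sym (assoc _ _ _) ∙ (⟨dom,cod⟩.π₂∘⟨⟩ dom cod ⟩∘ f) ∙ c
            ∙ (sym (⟨dom,cod⟩.π₂∘⟨⟩ X Y) ⟩∘ !) ∙ assoc _ _ _ )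

      element : ∀ {T} (f : Hom T C₁) → dom ∘ f ≡ X ∘ ! → cod ∘ f ≡ Y ∘ ! → Hom T object
      element f d c = universal f ! (cond f d c)

      abstract
        incl∘element : ∀ {T} (f : Hom T C₁) (d : dom ∘ f ≡ X ∘ !) (c : cod ∘ f ≡ Y ∘ !) →
                       incl ∘ element f d c ≡ f
        incl∘element f d c = p₁∘universal f ! (cond f d c)

    -- Global elements of ℂ(X , Y), identified with global elements of C₁;
    -- `name` gives the corresponding element of the hom-object.
    record GlobalArrow (X Y : Hom ⊤ C₀) : Set ℓ where
      constructor global
      field
        arr     : Hom ⊤ C₁
        dom-arr : dom ∘ arr ≡ X
        cod-arr : cod ∘ arr ≡ Y
    open GlobalArrow

    abstract
      global-≡ : ∀ {X Y} {u v : GlobalArrow X Y} → arr u ≡ arr v → u ≡ v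
      global-≡ {u = global a d c} {global .a d′ c′} refl
        with refl ← uip d d′ | refl ← uip c c′ = refl

    abstract
      !-≡ : ∀ {A} {f : Hom ⊤ A} → f ∘ ! ≡ f
      !-≡ {f = f} = (f ∘⟨ !-unique _ _) ∙ identityʳ f

    name : ∀ {X Y} → GlobalArrow X Y → Hom ⊤ (HomObj.object X Y)
    name {X} {Y} u =
      HomObj.element X Y (arr u) (dom-arr u ∙ sym (!-≡ {f = X})) (cod-arr u ∙ sym (!-≡ {f = Y}))

    abstract
      incl∘name : ∀ {X Y} (u : GlobalArrow X Y) → HomObj.incl X Y ∘ name u ≡ arr u
      incl∘name {X} {Y} u = HomObj.incl∘element X Y (arr u) (dom-arr u ∙ sym !-≡) (cod-arr u ∙ sym !-≡)

    Γ : Category ℓ ℓ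
    Γ = record
      { Obj       = Hom ⊤ C₀
      ; Hom       = GlobalArrow
      ; id        = λ {X} → global (ident ∘ X)
                      (sym (assoc _ _ _) ∙ (dom-ident ⟩∘ X) ∙ identityˡ X)
                      (sym (assoc _ _ _) ∙ (cod-ident ⟩∘ X) ∙ identityˡ X)
      ; _∘_       = λ g f → global (compose (arr g) (arr f) (dom-arr g ∙ sym (cod-arr f)))
                      (dom-compose ∙ dom-arr f) (cod-compose ∙ cod-arr g)
      ; identityˡ = λ f → global-≡
                      ( compose-cong {p′ = id-condˡ f} (ident ∘⟨ sym (cod-arr f)) refl
                      ∙ compose-identˡ (arr f) _ )
      ; identityʳ = λ f → global-≡
                      ( compose-cong {p′ = id-condʳ f} refl (ident ∘⟨ sym (dom-arr f))
                      ∙ compose-identʳ (arr f) _ )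
      ; assoc     = λ h g f → global-≡ (compose-assoc (arr h) (arr g) (arr f) _ _ _ _)
      }
      where
        abstract
          id-condˡ : ∀ {X Y} (f : GlobalArrow X Y) →
                     dom ∘ (ident ∘ (cod ∘ arr f)) ≡ cod ∘ arr f
          id-condˡ f = sym (assoc _ _ _) ∙ (dom-ident ⟩∘ _) ∙ identityˡ _
        abstract
          id-condʳ : ∀ {X Y} (f : GlobalArrow X Y) →
                     dom ∘ arr f ≡ cod ∘ (ident ∘ (dom ∘ arr f))
          id-condʳ f = sym (sym (assoc _ _ _) ∙ (cod-ident ⟩∘ _) ∙ identityˡ _)

  record InternalFunctor (ℂ 𝔻 : InternalCategory) : Set (o ⊔ ℓ) where
    private
      module C = Internal ℂ
      module D = Internal 𝔻
    field
      H₀    : Hom C.C₀ D.C₀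
      H₁    : Hom C.C₁ D.C₁
      dom   : D.dom ∘ H₁ ≡ H₀ ∘ C.dom
      cod   : D.cod ∘ H₁ ≡ H₀ ∘ C.cod
      ident : H₁ ∘ C.ident ≡ D.ident ∘ H₀

    H₁-composable : ∀ {T} {g f : Hom T C.C₁} → C.dom ∘ g ≡ C.cod ∘ f →
                    D.dom ∘ (H₁ ∘ g) ≡ D.cod ∘ (H₁ ∘ f)
    H₁-composable p =
        sym (assoc _ _ _) ∙ (dom ⟩∘ _) ∙ assoc _ _ _ ∙ (H₀ ∘⟨ p)
      ∙ sym (assoc _ _ _) ∙ (sym cod ⟩∘ _) ∙ assoc _ _ _

    field
      comp  : H₁ ∘ C.comp ≡
              D.compose (H₁ ∘ C.Pairs.p₁) (H₁ ∘ C.Pairs.p₂) (H₁-composable C.Pairs.commute)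

    abstract
      H₁-compose : ∀ {T} {g f : Hom T C.C₁} {p : C.dom ∘ g ≡ C.cod ∘ f}
                   {q : D.dom ∘ (H₁ ∘ g) ≡ D.cod ∘ (H₁ ∘ f)} →
                   H₁ ∘ C.compose g f p ≡ D.compose (H₁ ∘ g) (H₁ ∘ f) q
      H₁-compose {g = g} {f} {p} {q} =
          sym (assoc _ _ _) ∙ (comp ⟩∘ _)
        ∙ D.compose-∘ _ {q′} ∙ D.compose-cong e₁ e₂
        where
          e₁ : (H₁ ∘ C.Pairs.p₁) ∘ C.Pairs.universal g f p ≡ H₁ ∘ g
          e₁ = assoc _ _ _ ∙ (H₁ ∘⟨ C.Pairs.p₁∘universal g f p)
          e₂ : (H₁ ∘ C.Pairs.p₂) ∘ C.Pairs.universal g f p ≡ H₁ ∘ f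
          e₂ = assoc _ _ _ ∙ (H₁ ∘⟨ C.Pairs.p₂∘universal g f p)
          q′ : D.dom ∘ ((H₁ ∘ C.Pairs.p₁) ∘ C.Pairs.universal g f p) ≡
               D.cod ∘ ((H₁ ∘ C.Pairs.p₂) ∘ C.Pairs.universal g f p)
          q′ = (D.dom ∘⟨ e₁) ∙ q ∙ (D.cod ∘⟨ sym e₂)

  -- The induced functor Γℍ : Γℂ → Γ𝔻.
  Γmap : ∀ {ℂ 𝔻} → InternalFunctor ℂ 𝔻 → Functor (Internal.Γ ℂ) (Internal.Γ 𝔻)
  Γmap {ℂ} {𝔻} ℍ = record
    { F₀           = λ X → H₀ ∘ X
    ; F₁           = λ u → global (H₁ ∘ arr u)
                       (sym (assoc _ _ _) ∙ (dom ⟩∘ _) ∙ assoc _ _ _ ∙ (H₀ ∘⟨ dom-arr u))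
                       (sym (assoc _ _ _) ∙ (cod ⟩∘ _) ∙ assoc _ _ _ ∙ (H₀ ∘⟨ cod-arr u))
    ; identity     = D.global-≡ (sym (assoc _ _ _) ∙ (ident ⟩∘ _) ∙ assoc _ _ _)
    ; homomorphism = λ g f → D.global-≡ H₁-compose
    }
    where
      open InternalFunctor ℍ
      module D = Internal 𝔻
      open Internal using (global)
      open Internal.GlobalArrow

  record InternalFiniteLimits (ℂ : InternalCategory) : Set (o ⊔ ℓ) where
    open InternalCategory ℂ
    field
      one         : Hom ⊤ C₀
      bang        : Hom C₀ C₁
      dom-bang    : dom ∘ bang ≡ id
      cod-bang    : cod ∘ bang ≡ one ∘ !
      bang-unique : ∀ {T} (m : Hom T C₁) → cod ∘ m ≡ one ∘ ! → m ≡ bang ∘ (dom ∘ m)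

    -- Cospan: pairs (f , g) with a common codomain.  Square: pairs of
    -- composable pairs with f u = g v, i.e. commutative squares; π₁, π₂ choose
    -- a square on each cospan and med chooses the mediating arrow.
    module Cospan = Pullback (pullback cod cod)
    module Square = Pullback (pullback comp comp)

    sq-f : Hom Square.P C₁
    sq-f = Pairs.p₁ ∘ Square.p₁

    sq-u : Hom Square.P C₁
    sq-u = Pairs.p₂ ∘ Square.p₁

    sq-g : Hom Square.P C₁
    sq-g = Pairs.p₁ ∘ Square.p₂

    sq-v : Hom Square.P C₁
    sq-v = Pairs.p₂ ∘ Square.p₂

    cod-sq : cod ∘ sq-f ≡ cod ∘ sq-g
    cod-sq =
        sym (assoc _ _ _) ∙ (sym cod-comp ⟩∘ _) ∙ assoc _ _ _ ∙ (cod ∘⟨ Square.commute)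
      ∙ sym (assoc _ _ _) ∙ (cod-comp ⟩∘ _) ∙ assoc _ _ _

    cospan : Hom Square.P Cospan.P
    cospan = Cospan.universal sq-f sq-g cod-sq

    field
      π₁ π₂   : Hom Cospan.P C₁
      dom-π   : dom ∘ π₁ ≡ dom ∘ π₂
      cod-π₁  : dom ∘ Cospan.p₁ ≡ cod ∘ π₁
      cod-π₂  : dom ∘ Cospan.p₂ ≡ cod ∘ π₂
      commute : compose Cospan.p₁ π₁ cod-π₁ ≡ compose Cospan.p₂ π₂ cod-π₂

    apex : Hom Cospan.P C₀
    apex = dom ∘ π₁

    field
      med     : Hom Square.P C₁
      dom-med : dom ∘ med ≡ dom ∘ sq-u
      cod-med : cod ∘ med ≡ apex ∘ cospan

    med-composable₁ : dom ∘ (π₁ ∘ cospan) ≡ cod ∘ med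
    med-composable₁ = sym (assoc _ _ _) ∙ sym cod-med

    med-composable₂ : dom ∘ (π₂ ∘ cospan) ≡ cod ∘ med
    med-composable₂ = sym (assoc _ _ _) ∙ (sym dom-π ⟩∘ cospan) ∙ sym cod-med

    field
      π₁-med     : compose (π₁ ∘ cospan) med med-composable₁ ≡ sq-u
      π₂-med     : compose (π₂ ∘ cospan) med med-composable₂ ≡ sq-v
      med-unique : ∀ {T} (c : Hom T Cospan.P) (m n : Hom T C₁)
                   (m₁ : dom ∘ (π₁ ∘ c) ≡ cod ∘ m) (m₂ : dom ∘ (π₂ ∘ c) ≡ cod ∘ m)
                   (n₁ : dom ∘ (π₁ ∘ c) ≡ cod ∘ n) (n₂ : dom ∘ (π₂ ∘ c) ≡ cod ∘ n) →
                   compose (π₁ ∘ c) m m₁ ≡ compose (π₁ ∘ c) n n₁ →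
                   compose (π₂ ∘ c) m m₂ ≡ compose (π₂ ∘ c) n n₂ →
                   m ≡ n

  module InternalLimits {ℂ : InternalCategory} (𝕃 : InternalFiniteLimits ℂ) where
    open Internal ℂ
    open InternalFiniteLimits 𝕃 public

    module _ {T} {f g : Hom T C₁} (r : cod ∘ f ≡ cod ∘ g) where
      cs : Hom T Cospan.P
      cs = Cospan.universal f g r

      abstract
        cod-π₁-at : cod ∘ (π₁ ∘ cs) ≡ dom ∘ f
        cod-π₁-at = sym (assoc _ _ _) ∙ (sym cod-π₁ ⟩∘ cs) ∙ assoc _ _ _
                  ∙ (dom ∘⟨ Cospan.p₁∘universal f g r)

      abstract
        cod-π₂-at : cod ∘ (π₂ ∘ cs) ≡ dom ∘ g
        cod-π₂-at = sym (assoc _ _ _) ∙ (sym cod-π₂ ⟩∘ cs) ∙ assoc _ _ _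
                  ∙ (dom ∘⟨ Cospan.p₂∘universal f g r)

      abstract
        dom-π₁-at : dom ∘ (π₁ ∘ cs) ≡ apex ∘ cs
        dom-π₁-at = sym (assoc _ _ _)

      abstract
        dom-π₂-at : dom ∘ (π₂ ∘ cs) ≡ apex ∘ cs
        dom-π₂-at = sym (assoc _ _ _) ∙ (sym dom-π ⟩∘ cs)

      abstract
        commute-at : compose f (π₁ ∘ cs) (sym cod-π₁-at) ≡ compose g (π₂ ∘ cs) (sym cod-π₂-at)
        commute-at =
            compose-cong (sym (Cospan.p₁∘universal f g r)) refl
          ∙ sym (compose-∘ cs {compat cod-π₁}) ∙ (commute ⟩∘ cs)
          ∙ compose-∘ cs {compat cod-π₂}
          ∙ compose-cong (Cospan.p₂∘universal f g r) refl
          where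
            compat : ∀ {S} {a b : Hom S C₁} {t : Hom T S} → dom ∘ a ≡ cod ∘ b →
                     dom ∘ (a ∘ t) ≡ cod ∘ (b ∘ t)
            compat {t = t} e = sym (assoc _ _ _) ∙ (e ⟩∘ t) ∙ assoc _ _ _

      module Mediate {u v : Hom T C₁} (p : dom ∘ f ≡ cod ∘ u) (q : dom ∘ g ≡ cod ∘ v)
                     (e : compose f u p ≡ compose g v q) where
        sq : Hom T Square.P
        sq = Square.universal (Pairs.universal f u p) (Pairs.universal g v q) e

        abstract
          sq-f-at : sq-f ∘ sq ≡ f
          sq-f-at = assoc _ _ _ ∙ (_ ∘⟨ Square.p₁∘universal _ _ e) ∙ Pairs.p₁∘universal f u p

        abstract
          sq-u-at : sq-u ∘ sq ≡ u
          sq-u-at = assoc _ _ _ ∙ (_ ∘⟨ Square.p₁∘universal _ _ e) ∙ Pairs.p₂∘universal f u p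

        abstract
          sq-g-at : sq-g ∘ sq ≡ g
          sq-g-at = assoc _ _ _ ∙ (_ ∘⟨ Square.p₂∘universal _ _ e) ∙ Pairs.p₁∘universal g v q

        abstract
          sq-v-at : sq-v ∘ sq ≡ v
          sq-v-at = assoc _ _ _ ∙ (_ ∘⟨ Square.p₂∘universal _ _ e) ∙ Pairs.p₂∘universal g v q

        abstract
          cospan-at : cospan ∘ sq ≡ cs
          cospan-at = Cospan.unique _ _
            ( sym (assoc _ _ _) ∙ (Cospan.p₁∘universal _ _ cod-sq ⟩∘ sq) ∙ sq-f-at
            ∙ sym (Cospan.p₁∘universal f g r) )
            ( sym (assoc _ _ _) ∙ (Cospan.p₂∘universal _ _ cod-sq ⟩∘ sq) ∙ sq-g-at
            ∙ sym (Cospan.p₂∘universal f g r) )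

        med-at : Hom T C₁
        med-at = med ∘ sq

        abstract
          dom-med-at : dom ∘ med-at ≡ dom ∘ u
          dom-med-at = sym (assoc _ _ _) ∙ (dom-med ⟩∘ sq) ∙ assoc _ _ _ ∙ (dom ∘⟨ sq-u-at)

        abstract
          cod-med-at : cod ∘ med-at ≡ apex ∘ cs
          cod-med-at = sym (assoc _ _ _) ∙ (cod-med ⟩∘ sq) ∙ assoc _ _ _ ∙ (apex ∘⟨ cospan-at)

        private
          reassoc : ∀ (a : Hom Cospan.P C₁) → (a ∘ cospan) ∘ sq ≡ a ∘ cs
          reassoc a = assoc _ _ _ ∙ (a ∘⟨ cospan-at)

        abstract
          π₁-med-at : ∀ {d} → compose (π₁ ∘ cs) med-at d ≡ u
          π₁-med-at {d} = compose-cong (sym (reassoc π₁)) refl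
            ∙ sym (compose-∘ sq {(dom ∘⟨ reassoc π₁) ∙ d}) ∙ (π₁-med ⟩∘ sq) ∙ sq-u-at

        abstract
          π₂-med-at : ∀ {d} → compose (π₂ ∘ cs) med-at d ≡ v
          π₂-med-at {d} = compose-cong (sym (reassoc π₂)) refl
            ∙ sym (compose-∘ sq {(dom ∘⟨ reassoc π₂) ∙ d}) ∙ (π₂-med ⟩∘ sq) ∙ sq-v-at

    open GlobalArrow

    ΓLimits : FiniteLimits Γ
    ΓLimits = record
      { terminal = record
        { ⊤          = one
        ; isTerminal = record
          { !        = λ {X} → global (bang ∘ X)
                         (sym (assoc _ _ _) ∙ (dom-bang ⟩∘ X) ∙ identityˡ X)
                         (sym (assoc _ _ _) ∙ (cod-bang ⟩∘ X) ∙ assoc _ _ _ ∙ (one ∘⟨ !-unique _ _)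
                           ∙ identityʳ one)
          ; !-unique = λ f g → global-≡
              ( bang-unique (arr f) (cod-arr f ∙ sym !-≡)
              ∙ (bang ∘⟨ (dom-arr f ∙ sym (dom-arr g)))
              ∙ sym (bang-unique (arr g) (cod-arr g ∙ sym !-≡)) )
          }
        }
      ; pullback = ΓPullback
      }
      where
        ΓPullback : ∀ {X Y Z} (f : GlobalArrow X Z) (g : GlobalArrow Y Z) → Pullback Γ f g
        ΓPullback {X} {Y} f g = record
          { P          = apex ∘ cs r
          ; p₁         = P₁
          ; p₂         = P₂
          ; isPullback = record
            { commute      = global-≡
                ( compose-cong {p′ = sym (cod-π₁-at r)} refl refl
                ∙ commute-at r
                ∙ compose-cong refl refl )
            ; universal    = λ h k e → global (M.med-at h k e)
                (M.dom-med-at h k e ∙ dom-arr h) (M.cod-med-at h k e)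
            ; p₁∘universal = λ h k e → global-≡ (M.π₁-med-at h k e)
            ; p₂∘universal = λ h k e → global-≡ (M.π₂-med-at h k e)
            ; unique       = λ u v e₁ e₂ → global-≡
                (med-unique (cs r) (arr u) (arr v) _ _ _ _ (cong arr e₁) (cong arr e₂))
            }
          }
          where
            r : cod ∘ arr f ≡ cod ∘ arr g
            r = cod-arr f ∙ sym (cod-arr g)
            P₁ : GlobalArrow (apex ∘ cs r) X
            P₁ = global (π₁ ∘ cs r) (dom-π₁-at r) (cod-π₁-at r ∙ dom-arr f)
            P₂ : GlobalArrow (apex ∘ cs r) Y
            P₂ = global (π₂ ∘ cs r) (dom-π₂-at r) (cod-π₂-at r ∙ dom-arr g)
            module M {Q} (h : GlobalArrow Q X) (k : GlobalArrow Q Y)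
                     (e : Category._∘_ Γ f h ≡ Category._∘_ Γ g k) =
              Mediate r (dom-arr f ∙ sym (cod-arr h)) (dom-arr g ∙ sym (cod-arr k)) (cong arr e)

    -- The global section functor γ = ℂ(1 , -).
    private
      module From (X : Hom ⊤ C₀) = HomObj one X

      abstract
        past-! : ∀ {S T A} {x : Hom ⊤ A} {m : Hom S A} (t : Hom T S) → m ≡ x ∘ ! → m ∘ t ≡ x ∘ !
        past-! {x = x} t e = (e ⟩∘ t) ∙ assoc _ _ _ ∙ (x ∘⟨ !-unique _ _)

      abstract
        at-! : ∀ {T A B} {a : Hom A B} {m : Hom ⊤ A} {x : Hom ⊤ B} →
               a ∘ m ≡ x → a ∘ (m ∘ ! {T}) ≡ x ∘ !
        at-! e = sym (assoc _ _ _) ∙ (e ⟩∘ !)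

      abstract
        act-cond : ∀ {X Y T} (f : GlobalArrow X Y) (m : Hom T C₁) → cod ∘ m ≡ X ∘ ! →
                   dom ∘ (arr f ∘ !) ≡ cod ∘ m
        act-cond f m c = at-! (dom-arr f) ∙ sym c

    act : ∀ {X Y T} (f : GlobalArrow X Y) (m : Hom T C₁) → cod ∘ m ≡ X ∘ ! → Hom T C₁
    act f m c = compose (arr f ∘ !) m (act-cond f m c)

    abstract
      cod-incl-∘ : ∀ {X T} (t : Hom T (From.object X)) → cod ∘ (From.incl X ∘ t) ≡ X ∘ !
      cod-incl-∘ {X} t = sym (assoc _ _ _) ∙ past-! t (From.cod-incl X)

    abstract
      dom-incl-∘ : ∀ {X T} (t : Hom T (From.object X)) → dom ∘ (From.incl X ∘ t) ≡ one ∘ !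
      dom-incl-∘ {X} t = sym (assoc _ _ _) ∙ past-! t (From.dom-incl X)

    γ₁ : ∀ {X Y} → GlobalArrow X Y → Hom (From.object X) (From.object Y)
    γ₁ {X} {Y} f = From.element Y (act f (From.incl X) (From.cod-incl X))
      (dom-compose ∙ From.dom-incl X) (cod-compose ∙ at-! (cod-arr f))

    abstract
      incl∘γ₁ : ∀ {X Y T} (f : GlobalArrow X Y) (t : Hom T (From.object X)) →
                From.incl Y ∘ (γ₁ f ∘ t) ≡ act f (From.incl X ∘ t) (cod-incl-∘ t)
      incl∘γ₁ {X} {Y} f t =
          sym (assoc _ _ _)
        ∙ (From.incl∘element Y (act f (From.incl X) (From.cod-incl X)) _ _ ⟩∘ t)
        ∙ compose-∘ t {sym (assoc _ _ _) ∙ (act-cond f _ (From.cod-incl X) ⟩∘ t) ∙ assoc _ _ _}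
        ∙ compose-cong (assoc _ _ _ ∙ (arr f ∘⟨ !-unique _ _)) refl

    abstract
      incl∘γ₁′ : ∀ {X Y} (f : GlobalArrow X Y) →
                 From.incl Y ∘ γ₁ f ≡ act f (From.incl X) (From.cod-incl X)
      incl∘γ₁′ {X} {Y} f = From.incl∘element Y (act f (From.incl X) (From.cod-incl X)) _ _

    γ : Functor Γ ℬ
    γ = record
      { F₀           = From.object
      ; F₁           = γ₁
      ; identity     = λ {X} → From.incl-mono X _ _
          ( incl∘γ₁′ (Category.id Γ)
          ∙ compose-cong {p′ = id-cond X} (assoc _ _ _ ∙ (ident ∘⟨ sym (From.cod-incl X))) refl
          ∙ compose-identˡ (From.incl X) (id-cond X)
          ∙ sym (identityʳ _) )
      ; homomorphism = λ {X} {Y} {Z} g f → From.incl-mono Z _ _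
          ( incl∘γ₁′ (Category._∘_ Γ g f)
          ∙ compose-cong {p′ = dom-compose ∙ act-cond f _ (From.cod-incl X)}
              (compose-∘ ! {at-! (dom-arr g) ∙ sym (at-! (cod-arr f))}) refl
          ∙ compose-assoc (arr g ∘ !) (arr f ∘ !) (From.incl X)
              (at-! (dom-arr g) ∙ sym (at-! (cod-arr f))) (act-cond f _ (From.cod-incl X))
              (dom-compose ∙ act-cond f _ (From.cod-incl X))
              (at-! (dom-arr g) ∙ sym (cod-compose ∙ at-! (cod-arr f)))
          ∙ compose-cong refl (sym (incl∘γ₁′ f))
          ∙ sym (incl∘γ₁ g (γ₁ f)) )
      }
      where
        abstract
          id-cond : ∀ X → dom ∘ (ident ∘ (cod ∘ From.incl X)) ≡ cod ∘ From.incl X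
          id-cond X = sym (assoc _ _ _) ∙ (dom-ident ⟩∘ _) ∙ identityˡ _

    γ-preserves : PreservesFiniteLimits ΓLimits γ
    γ-preserves = record
      { preserves-⊤  = record
        { !        = From.element one (bang ∘ (one ∘ !))
            (sym (assoc _ _ _) ∙ (dom-bang ⟩∘ _) ∙ identityˡ _)
            (sym (assoc _ _ _) ∙ past-! _ cod-bang)
        ; !-unique = λ f g → From.incl-mono one f g (to-bang f ∙ sym (to-bang g))
        }
      ; preserves-pb = γ-pb
      }
      where
        abstract
          to-bang : ∀ {T} (f : Hom T (From.object one)) → From.incl one ∘ f ≡ bang ∘ (one ∘ !)
          to-bang f = bang-unique _ (cod-incl-∘ f) ∙ (bang ∘⟨ dom-incl-∘ f)

        γ-pb : ∀ {X Y Z} (f : GlobalArrow X Z) (g : GlobalArrow Y Z) →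
               let module Q = Pullback (FiniteLimits.pullback ΓLimits f g) in
               IsPullback ℬ (γ₁ Q.p₁) (γ₁ Q.p₂) (γ₁ f) (γ₁ g)
        γ-pb {X} {Y} {Z} f g = record
          { commute      = sym (Functor.homomorphism γ f Q.p₁) ∙ cong γ₁ Q.commute
                           ∙ Functor.homomorphism γ g Q.p₂
          ; universal    = U
          ; p₁∘universal = λ h k e → From.incl-mono X _ _
              ( incl∘γ₁ Q.p₁ (U h k e)
              ∙ compose-cong {p′ = sym (assoc _ _ _) ∙ sym (M.cod-med-at h k e)}
                  (cs-! π₁) (incl∘U h k e)
              ∙ M.π₁-med-at h k e )
          ; p₂∘universal = λ h k e → From.incl-mono Y _ _
              ( incl∘γ₁ Q.p₂ (U h k e)
              ∙ compose-cong {p′ = dom-π₂-at r! ∙ sym (M.cod-med-at h k e)}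
                  (cs-! π₂) (incl∘U h k e)
              ∙ M.π₂-med-at h k e )
          ; unique       = λ u v e₁ e₂ → From.incl-mono Q.P u v
              (med-unique (cs r!) _ _
                (c₁ u) (c₂ u) (c₁ v) (c₂ v)
                (into Q.p₁ π₁ refl u (c₁ u) ∙ (From.incl X ∘⟨ e₁) ∙ sym (into Q.p₁ π₁ refl v (c₁ v)))
                (into Q.p₂ π₂ refl u (c₂ u) ∙ (From.incl Y ∘⟨ e₂) ∙ sym (into Q.p₂ π₂ refl v (c₂ v))))
          }
          where
            module Q = Pullback (FiniteLimits.pullback ΓLimits f g)
            r : cod ∘ arr f ≡ cod ∘ arr g
            r = cod-arr f ∙ sym (cod-arr g)

            abstract
              r! : ∀ {T} → cod ∘ (arr f ∘ ! {T}) ≡ cod ∘ (arr g ∘ !)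
              r! = at-! (cod-arr f) ∙ sym (at-! (cod-arr g))

            abstract
              cs∘! : ∀ {T} → cs r ∘ ! {T} ≡ cs r!
              cs∘! = Cospan.unique _ _
                ( sym (assoc _ _ _) ∙ (Cospan.p₁∘universal _ _ r ⟩∘ !)
                ∙ sym (Cospan.p₁∘universal _ _ r!) )
                ( sym (assoc _ _ _) ∙ (Cospan.p₂∘universal _ _ r ⟩∘ !)
                ∙ sym (Cospan.p₂∘universal _ _ r!) )

            abstract
              cs-! : ∀ {T A} (a : Hom Cospan.P A) → (a ∘ cs r) ∘ ! {T} ≡ a ∘ cs r!
              cs-! a = assoc _ _ _ ∙ (a ∘⟨ cs∘!)

            module M {T} (h : Hom T (From.object X)) (k : Hom T (From.object Y))
                     (e : γ₁ f ∘ h ≡ γ₁ g ∘ k) =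
              Mediate r! (act-cond f _ (cod-incl-∘ h)) (act-cond g _ (cod-incl-∘ k))
                (sym (incl∘γ₁ f h) ∙ (From.incl Z ∘⟨ e) ∙ incl∘γ₁ g k)

            U : ∀ {T} (h : Hom T (From.object X)) (k : Hom T (From.object Y)) →
                γ₁ f ∘ h ≡ γ₁ g ∘ k → Hom T (From.object Q.P)
            U h k e = From.element Q.P (M.med-at h k e)
              (M.dom-med-at h k e ∙ dom-incl-∘ h) (M.cod-med-at h k e ∙ sym (cs-! apex))

            abstract
              incl∘U : ∀ {T} (h : Hom T (From.object X)) (k : Hom T (From.object Y))
                       (e : γ₁ f ∘ h ≡ γ₁ g ∘ k) → From.incl Q.P ∘ U h k e ≡ M.med-at h k e
              incl∘U h k e = From.incl∘element Q.P _ _ _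

            abstract
              cod-at : ∀ {T} (u : Hom T (From.object Q.P)) →
                       apex ∘ cs r! ≡ cod ∘ (From.incl Q.P ∘ u)
              cod-at u = sym (cs-! apex) ∙ sym (cod-incl-∘ u)

            abstract
              c₁ : ∀ {T} (u : Hom T (From.object Q.P)) →
                   dom ∘ (π₁ ∘ cs r!) ≡ cod ∘ (From.incl Q.P ∘ u)
              c₁ u = dom-π₁-at r! ∙ cod-at u

            abstract
              c₂ : ∀ {T} (u : Hom T (From.object Q.P)) →
                   dom ∘ (π₂ ∘ cs r!) ≡ cod ∘ (From.incl Q.P ∘ u)
              c₂ u = dom-π₂-at r! ∙ cod-at u

            abstract
              into : ∀ {T W} (p : GlobalArrow Q.P W) (a : Hom Cospan.P C₁) → arr p ≡ a ∘ cs r →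
                     (u : Hom T (From.object Q.P)) (d : dom ∘ (a ∘ cs r!) ≡ cod ∘ (From.incl Q.P ∘ u)) →
                     compose (a ∘ cs r!) (From.incl Q.P ∘ u) d ≡ From.incl W ∘ (γ₁ p ∘ u)
              into p a e u d = compose-cong (sym ((e ⟩∘ !) ∙ cs-! a)) refl ∙ sym (incl∘γ₁ p u)

------------------------------------------------------------------------

module Apply {𝒞 : Category o ℓ} {𝒟 : Category o′ ℓ′} {L : FiniteLimits 𝒞} {L′ : FiniteLimits 𝒟}
             (G : Functor 𝒞 𝒟) (G-preserves : PreservesFiniteLimits L G)
             (ℂ : InternalCategory L) where
  private
    module C = Category 𝒞
    module I = Internal L ℂ
    module L = FiniteLimits L
    module L′ = FiniteLimits L′
  open Category 𝒟
  open Functor G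
  open PreservesFiniteLimits G-preserves

  module GPairs = IsPullback (preserves-pb I.dom I.cod)
  private module Pairs′ = Pullback (L′.pullback (F₁ I.dom) (F₁ I.cod))

  Gcomp : Hom Pairs′.P (F₀ I.C₁)
  Gcomp = F₁ I.comp ∘ GPairs.universal Pairs′.p₁ Pairs′.p₂ Pairs′.commute

  abstract
    Gcompose : ∀ {T} {g f : Hom T (F₀ I.C₁)} {p : F₁ I.dom ∘ g ≡ F₁ I.cod ∘ f} →
               Gcomp ∘ Pairs′.universal g f p ≡ F₁ I.comp ∘ GPairs.universal g f p
    Gcompose {g = g} {f} {p} = assoc _ _ _ ∙ (F₁ I.comp ∘⟨ GPairs.unique _ _
      ( sym (assoc _ _ _) ∙ (GPairs.p₁∘universal _ _ Pairs′.commute ⟩∘ _)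
      ∙ Pairs′.p₁∘universal g f p ∙ sym (GPairs.p₁∘universal g f p) )
      ( sym (assoc _ _ _) ∙ (GPairs.p₂∘universal _ _ Pairs′.commute ⟩∘ _)
      ∙ Pairs′.p₂∘universal g f p ∙ sym (GPairs.p₂∘universal g f p) ))

    Gcompose-image : ∀ {S T} {g′ f′ : Hom T (F₀ I.C₁)} {p′ : F₁ I.dom ∘ g′ ≡ F₁ I.cod ∘ f′}
                     (g f : C.Hom S I.C₁) (p : I.dom C.∘ g ≡ I.cod C.∘ f) (t : Hom T (F₀ S)) →
                     g′ ≡ F₁ g ∘ t → f′ ≡ F₁ f ∘ t →
                     Gcomp ∘ Pairs′.universal g′ f′ p′ ≡ F₁ (I.compose g f p) ∘ t
    Gcompose-image {g′ = g′} {f′} {p′} g f p t eg ef =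
        Gcompose
      ∙ (F₁ I.comp ∘⟨ GPairs.unique _ _
          ( GPairs.p₁∘universal g′ f′ p′ ∙ eg
          ∙ ((cong F₁ (sym (I.Pairs.p₁∘universal g f p)) ∙ homomorphism _ _) ⟩∘ t) ∙ assoc _ _ _ )
          ( GPairs.p₂∘universal g′ f′ p′ ∙ ef
          ∙ ((cong F₁ (sym (I.Pairs.p₂∘universal g f p)) ∙ homomorphism _ _) ⟩∘ t) ∙ assoc _ _ _ ))
      ∙ sym (assoc _ _ _) ∙ (sym (homomorphism _ _) ⟩∘ t)

    private
      F₁-id-∘ : ∀ {T A} {t : Hom T (F₀ A)} → F₁ C.id ∘ t ≡ t
      F₁-id-∘ = (identity ⟩∘ _) ∙ identityˡ _

      F₁-∘-∘ : ∀ {T X Y Z} (g : C.Hom Y Z) (f : C.Hom X Y) (t : Hom T (F₀ X)) →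
               F₁ (g C.∘ f) ∘ t ≡ F₁ g ∘ (F₁ f ∘ t)
      F₁-∘-∘ g f t = (homomorphism g f ⟩∘ t) ∙ assoc _ _ _

      F₁-square-∘ : ∀ {T S X Y Z} {g : C.Hom Y Z} {f : C.Hom S Y} {g′ : C.Hom X Z} {f′ : C.Hom S X}
                    (t : Hom T (F₀ S)) → g C.∘ f ≡ g′ C.∘ f′ →
                    F₁ g ∘ (F₁ f ∘ t) ≡ F₁ g′ ∘ (F₁ f′ ∘ t)
      F₁-square-∘ t e = sym (F₁-∘-∘ _ _ t) ∙ (cong F₁ e ⟩∘ t) ∙ F₁-∘-∘ _ _ t

    Gdom-comp : F₁ I.dom ∘ Gcomp ≡ F₁ I.dom ∘ Pairs′.p₂
    Gdom-comp = F₁-square-∘ _ I.dom-comp ∙ (_ ∘⟨ GPairs.p₂∘universal _ _ Pairs′.commute)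

    Gcod-comp : F₁ I.cod ∘ Gcomp ≡ F₁ I.cod ∘ Pairs′.p₁
    Gcod-comp = F₁-square-∘ _ I.cod-comp ∙ (_ ∘⟨ GPairs.p₁∘universal _ _ Pairs′.commute)

    Gidentˡ : ∀ {T} (f : Hom T (F₀ I.C₁))
              (p : F₁ I.dom ∘ (F₁ I.ident ∘ (F₁ I.cod ∘ f)) ≡ F₁ I.cod ∘ f) →
              Gcomp ∘ Pairs′.universal (F₁ I.ident ∘ (F₁ I.cod ∘ f)) f p ≡ f
    Gidentˡ f p =
        Gcompose-image (I.ident C.∘ (I.cod C.∘ C.id)) C.id cond f
          ( (_ ∘⟨ ((cong F₁ (sym (C.identityʳ I.cod))) ⟩∘ f)) ∙ sym (F₁-∘-∘ _ _ f) )
          (sym F₁-id-∘)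
      ∙ (cong F₁ (I.compose-identˡ C.id cond) ⟩∘ f) ∙ F₁-id-∘
      where
        cond : I.dom C.∘ (I.ident C.∘ (I.cod C.∘ C.id)) ≡ I.cod C.∘ C.id
        cond = sym (C.assoc _ _ _) ∙ (I.dom-ident C.⟩∘ _) ∙ C.identityˡ _

    Gidentʳ : ∀ {T} (f : Hom T (F₀ I.C₁))
              (p : F₁ I.dom ∘ f ≡ F₁ I.cod ∘ (F₁ I.ident ∘ (F₁ I.dom ∘ f))) →
              Gcomp ∘ Pairs′.universal f (F₁ I.ident ∘ (F₁ I.dom ∘ f)) p ≡ f
    Gidentʳ f p =
        Gcompose-image C.id (I.ident C.∘ (I.dom C.∘ C.id)) cond f (sym F₁-id-∘)
          ( (_ ∘⟨ ((cong F₁ (sym (C.identityʳ I.dom))) ⟩∘ f)) ∙ sym (F₁-∘-∘ _ _ f) )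
      ∙ (cong F₁ (I.compose-identʳ C.id cond) ⟩∘ f) ∙ F₁-id-∘
      where
        cond : I.dom C.∘ C.id ≡ I.cod C.∘ (I.ident C.∘ (I.dom C.∘ C.id))
        cond = sym (sym (C.assoc _ _ _) ∙ (I.cod-ident C.⟩∘ _) ∙ C.identityˡ _)

    Gassoc : ∀ {T} (h g f : Hom T (F₀ I.C₁))
             (p : F₁ I.dom ∘ h ≡ F₁ I.cod ∘ g) (q : F₁ I.dom ∘ g ≡ F₁ I.cod ∘ f)
             (r : F₁ I.dom ∘ (Gcomp ∘ Pairs′.universal h g p) ≡ F₁ I.cod ∘ f)
             (s : F₁ I.dom ∘ h ≡ F₁ I.cod ∘ (Gcomp ∘ Pairs′.universal g f q)) →
             Gcomp ∘ Pairs′.universal (Gcomp ∘ Pairs′.universal h g p) f r ≡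
             Gcomp ∘ Pairs′.universal h (Gcomp ∘ Pairs′.universal g f q) s
    Gassoc {T} h g f p q r s =
        Gcompose-image (I.compose c b cb) a cb-a t (Gcompose-image c b cb t eh eg) ef
      ∙ (cong F₁ (I.compose-assoc c b a cb ba cb-a c-ba) ⟩∘ t)
      ∙ sym (Gcompose-image c (I.compose b a ba) c-ba t eh (Gcompose-image b a ba t eg ef))
      where
        module C₃ = Pullback (L.pullback I.Pairs.p₂ I.Pairs.p₁)
        module GC₃ = IsPullback (preserves-pb I.Pairs.p₂ I.Pairs.p₁)
        c b a : C.Hom C₃.P I.C₁
        c = I.Pairs.p₁ C.∘ C₃.p₁
        b = I.Pairs.p₂ C.∘ C₃.p₁
        a = I.Pairs.p₂ C.∘ C₃.p₂
        cb : I.dom C.∘ c ≡ I.cod C.∘ b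
        cb = sym (C.assoc _ _ _) ∙ (I.Pairs.commute C.⟩∘ _) ∙ C.assoc _ _ _
        ba : I.dom C.∘ b ≡ I.cod C.∘ a
        ba = (I.dom C.∘⟨ C₃.commute) ∙ sym (C.assoc _ _ _) ∙ (I.Pairs.commute C.⟩∘ _) ∙ C.assoc _ _ _
        cb-a : I.dom C.∘ I.compose c b cb ≡ I.cod C.∘ a
        cb-a = I.dom-compose ∙ ba
        c-ba : I.dom C.∘ c ≡ I.cod C.∘ I.compose b a ba
        c-ba = cb ∙ sym I.cod-compose
        mid : F₁ I.Pairs.p₂ ∘ GPairs.universal h g p ≡ F₁ I.Pairs.p₁ ∘ GPairs.universal g f q
        mid = GPairs.p₂∘universal h g p ∙ sym (GPairs.p₁∘universal g f q)
        t : Hom T (F₀ C₃.P)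
        t = GC₃.universal (GPairs.universal h g p) (GPairs.universal g f q) mid
        eh : h ≡ F₁ c ∘ t
        eh = sym (F₁-∘-∘ _ _ t ∙ (_ ∘⟨ GC₃.p₁∘universal _ _ mid) ∙ GPairs.p₁∘universal h g p)
        eg : g ≡ F₁ b ∘ t
        eg = sym (F₁-∘-∘ _ _ t ∙ (_ ∘⟨ GC₃.p₁∘universal _ _ mid) ∙ GPairs.p₂∘universal h g p)
        ef : f ≡ F₁ a ∘ t
        ef = sym (F₁-∘-∘ _ _ t ∙ (_ ∘⟨ GC₃.p₂∘universal _ _ mid) ∙ GPairs.p₂∘universal g f q)

  image : InternalCategory L′
  image = record
    { C₀             = F₀ I.C₀
    ; C₁             = F₀ I.C₁
    ; dom            = F₁ I.dom
    ; cod            = F₁ I.cod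
    ; ident          = F₁ I.ident
    ; comp           = Gcomp
    ; dom-ident      = sym (homomorphism _ _) ∙ cong F₁ I.dom-ident ∙ identity
    ; cod-ident      = sym (homomorphism _ _) ∙ cong F₁ I.cod-ident ∙ identity
    ; dom-comp       = Gdom-comp
    ; cod-comp       = Gcod-comp
    ; compose-identˡ = Gidentˡ
    ; compose-identʳ = Gidentʳ
    ; compose-assoc  = Gassoc
    }

  private module J = Internal L′ image

  -- 1 ≅ G1.
  ι : Hom L′.⊤ (F₀ L.⊤)
  ι = IsTerminal.! preserves-⊤

  -- G^# : Γℂ → ΓGℂ.
  ♯ : Functor I.Γ J.Γ
  ♯ = record
    { F₀           = λ X → F₁ X ∘ ι
    ; F₁           = λ u → J.global (F₁ (arr u) ∘ ι)
                       (sym (F₁-∘-∘ _ _ ι) ∙ (cong F₁ (dom-arr u) ⟩∘ ι))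
                       (sym (F₁-∘-∘ _ _ ι) ∙ (cong F₁ (cod-arr u) ⟩∘ ι))
    ; identity     = J.global-≡ (F₁-∘-∘ _ _ ι)
    ; homomorphism = λ g f → J.global-≡ (sym (Gcompose-image (arr g) (arr f) _ ι refl refl))
    }
    where open Internal.GlobalArrow

------------------------------------------------------------------------

module Box {ℬ : Category o ℓ} (L : FiniteLimits ℬ)
           {ℂ : InternalCategory L} (𝕃 : InternalFiniteLimits L ℂ)
           (F : Functor ℬ (Internal.Γ L ℂ))
           (F-strict : StrictlyPreservesFiniteLimits L F (InternalLimits.ΓLimits L 𝕃)) where
  open Category ℬ
  open FiniteLimits L
  open Internal L ℂ
  open InternalLimits L 𝕃 using (one; γ; γ₁; γ-preserves; ΓLimits; incl∘γ₁)
  private module F = Functor F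

  □ : Functor ℬ ℬ
  □ = γ ∘F F

  F-preserves : PreservesFiniteLimits L F
  F-preserves = strict⇒preserves F-strict

  □-preserves : PreservesFiniteLimits L □
  □-preserves = ∘-preserves γ-preserves F-strict

  module Fℂ = Apply {L′ = ΓLimits} F F-preserves ℂ
  module □ℂ = Apply {L′ = L} □ □-preserves ℂ
  private
    module ΓFℂ = Internal ΓLimits Fℂ.image
    module Γ□ℂ = Internal L □ℂ.image

  abstract
    γ₁∘name : ∀ {X Y} (k : GlobalArrow X Y) (m : GlobalArrow one X) →
              γ₁ k ∘ name m ≡ name (Category._∘_ Γ k m)
    γ₁∘name {X} {Y} k m = HomObj.incl-mono one Y _ _
      ( incl∘γ₁ k (name m)
      ∙ compose-cong !-≡ (incl∘name m)
      ∙ sym (incl∘name (Category._∘_ Γ k m)) )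

    name-compose : ∀ {g f : GlobalArrow one (F.F₀ C₁)}
                   (p : Category._∘_ Γ (F.F₁ dom) g ≡ Category._∘_ Γ (F.F₁ cod) f)
                   (q : γ₁ (F.F₁ dom) ∘ name g ≡ γ₁ (F.F₁ cod) ∘ name f) →
                   name (ΓFℂ.compose g f p) ≡ Γ□ℂ.compose (name g) (name f) q
    name-compose {g} {f} p q =
        cong name Fℂ.Gcompose
      ∙ sym (γ₁∘name (F.F₁ comp) (Fℂ.GPairs.universal g f p))
      ∙ (_ ∘⟨ □ℂ.GPairs.unique _ _
          ( γ₁∘name _ _ ∙ cong name (Fℂ.GPairs.p₁∘universal g f p)
          ∙ sym (□ℂ.GPairs.p₁∘universal _ _ q) )
          ( γ₁∘name _ _ ∙ cong name (Fℂ.GPairs.p₂∘universal g f p)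
          ∙ sym (□ℂ.GPairs.p₂∘universal _ _ q) ))
      ∙ sym □ℂ.Gcompose

  -- The canonical isomorphism ΓFℂ ≅ Γ□ℂ: it is bijective on objects and on
  -- morphisms because `name` identifies the morphisms 1 → FA of Γℂ with the
  -- global elements of □A = ℂ(1 , FA).
  canonical : Functor ΓFℂ.Γ Γ□ℂ.Γ
  canonical = record
    { F₀           = name
    ; F₁           = λ u → Γ□ℂ.global (name (arr u))
                       (γ₁∘name _ _ ∙ cong name (dom-arr u))
                       (γ₁∘name _ _ ∙ cong name (cod-arr u))
    ; identity     = λ {X} → Γ□ℂ.global-≡ (sym (γ₁∘name _ X))
    ; homomorphism = λ g f → Γ□ℂ.global-≡ (name-compose _ _)
    }
    where open Internal.GlobalArrow

record PreGeminal (o ℓ : Level) : Set (lsuc (o ⊔ ℓ)) where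
  field
    ℬ        : Category o ℓ
    limits   : FiniteLimits ℬ
    ℂ        : InternalCategory limits
    ℂ-limits : InternalFiniteLimits limits ℂ
  open Internal limits ℂ using (Γ)
  open InternalLimits limits ℂ-limits using (ΓLimits)
  field
    F        : Functor ℬ Γ
    F-strict : StrictlyPreservesFiniteLimits limits F ΓLimits
  open Box limits ℂ-limits F F-strict
  field
    ℍ        : InternalFunctor limits ℂ □ℂ.image
    ℍ-F      : Γmap limits ℍ ∘F F ≡F canonical ∘F Fℂ.♯ ∘F F

------------------------------------------------------------------------

module _ (𝒢 : PreGeminal o ℓ) where
  open PreGeminal 𝒢
  open Category ℬ
  open FiniteLimits limits
  open Internal limits ℂ
  open GlobalArrow
  private module F = Functor F

  -- A morphism f : A → B is coded by F f, a global element of ℂ(FA , FB).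
  ⌜Hom⌝ : Obj → Obj → Obj
  ⌜Hom⌝ A B = HomObj.object (F.F₀ A) (F.F₀ B)

  ⌜hom⌝ : ∀ {A B} → Hom A B → Hom ⊤ (⌜Hom⌝ A B)
  ⌜hom⌝ f = name (F.F₁ f)

  -- The object |ℂ/FA| of arrows of ℂ with codomain FA.  An object x : X → A of
  -- the fibre ℬ/A is coded by the arrow F x.
  module ObjOver (A : Obj) = Pullback (pullback cod (F.F₀ A))

  ⌜over⌝ : ∀ {A X} → Hom X A → Hom ⊤ (ObjOver.P A)
  ⌜over⌝ {A} x = ObjOver.universal A (arr (F.F₁ x)) id (cod-arr (F.F₁ x) ∙ sym (identityʳ _))

  -- The fibre of dom_D over A is ℬ(A , D), coded in ℂ(FA , FD).
  dom-codes : ∀ D → Codes terminal products (dom-fibration ℬ D)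
  dom-codes D = record
    { ⌜E_⌝   = λ A → ⌜Hom⌝ A D
    ; ⌜_⌝ᴱ   = λ { (slice x over refl) → ⌜hom⌝ x }
    ; ⌜B_,_⌝ = ⌜Hom⌝
    ; ⌜_⌝ᴮ   = ⌜hom⌝
    }

  cod-codes : Codes terminal products (cod-fibration ℬ limits)
  cod-codes = record
    { ⌜E_⌝   = ObjOver.P
    ; ⌜_⌝ᴱ   = λ { (arrow x over refl) → ⌜over⌝ x }
    ; ⌜B_,_⌝ = ⌜Hom⌝
    ; ⌜_⌝ᴮ   = ⌜hom⌝
    }

{-# OPTIONS --safe #-}

-- All four comparisons of the code structures hold as equalities of morphisms.
-- Substitution in dom_D is coded by composition in ℂ, and in cod by the
-- internal chosen pullbacks, which F preserves strictly.  Self-coding comes from ℍ: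
-- the objects of codes are pullbacks of C₁ over a global element, □ preserves
-- them, so H₁ restricts to a map S → □S; by ℍ ∘ F = F^# ∘ F it sends the code s
-- of an object to □s ∘ ι, which is the code of s.
module Submission where

open import Level using (Level)
open import Data.Product using (_×_; _,_; proj₁; proj₂; Σ-syntax)
open import Relation.Binary.PropositionalEquality using (_≡_; refl; sym; cong)
  renaming (trans to infixr 5 _∙_)
open import Defs

private
  variable
    o ℓ o′ ℓ′ : Level

-- Preliminaries on `≈` and on preserved products.

module _ {ℬ : Category o ℓ} (𝟙 : Terminal ℬ) (products : BinaryProducts ℬ)
         (p : ClovenFibration o′ ℓ′ ℬ) where
  open CodeStructures 𝟙 products p using (_≈_; reindexings-isomorphic)
  open ClovenFibration p using (Fib)

  ≡⇒≈ : ∀ {A B} {f f′ : Category.Hom ℬ A B} → f ≡ f′ → f ≈ f′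
  ≡⇒≈ {A} refl = reindexings-isomorphic record
    { η       = λ _ → id
    ; η⁻¹     = λ _ → id
    ; isoˡ    = λ _ → identityˡ id
    ; isoʳ    = λ _ → identityˡ id
    ; natural = λ _ → identityˡ _ ∙ sym (identityʳ _)
    }
    where open Category (Fib A)

module _ {𝒞 : Category o ℓ} {𝒟 : Category o′ ℓ′} {L : FiniteLimits 𝒞} {G : Functor 𝒞 𝒟} where
  open Category 𝒟
  open Functor G
  open FiniteLimits L

  abstract
    -- The chosen product is a pullback over the terminal object, so its image under `G` is a
    -- pullback and inherits the uniqueness clause.
    preserves-product-monic : PreservesFiniteLimits L G → ∀ A B →
      let module P = Product (products A B) in
      ∀ {T} (u v : Hom T (F₀ P.A×B)) →
      F₁ P.π₁ ∘ u ≡ F₁ P.π₁ ∘ v → F₁ P.π₂ ∘ u ≡ F₁ P.π₂ ∘ v → u ≡ v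
    preserves-product-monic preserves A B =
      IsPullback.unique (PreservesFiniteLimits.preserves-pb preserves (! {A}) (! {B}))

-- Composition and pullback as operations on codes in an internal category.

module _ {ℬ : Category o ℓ} (L : FiniteLimits ℬ) (ℂ : InternalCategory L) where
  open Category ℬ
  open FiniteLimits L
  open Internal L ℂ
  open GlobalArrow

  -- Underlying arrows all live in `Hom ⊤ C₁`, whatever their endpoints, so a strict equality of
  -- functors into `Γ` can be read there without transport.
  coe-conjugate-arr : ∀ {X X′ Y Y′} (p : X ≡ X′) (q : Y ≡ Y′)
                      (u : GlobalArrow X Y) (v : GlobalArrow X′ Y′) →
                      Category._∘_ Γ (Category.coe Γ q) u ≡ Category._∘_ Γ v (Category.coe Γ p) →
                      arr u ≡ arr v
  coe-conjugate-arr refl refl u v e =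
    cong arr (sym (Category.identityˡ Γ _) ∙ e ∙ Category.identityʳ Γ _)

  ≡F⇒arr-≡ : {𝒞 : Category o′ ℓ′} {G G′ : Functor 𝒞 Γ} → G ≡F G′ →
             ∀ {A B} (f : Category.Hom 𝒞 A B) → arr (Functor.F₁ G f) ≡ arr (Functor.F₁ G′ f)
  ≡F⇒arr-≡ e f = coe-conjugate-arr (_≡F_.eq₀ e _) (_≡F_.eq₀ e _) _ _ (_≡F_.eq₁ e f)

  module HomComposition (X Y Z : Hom ⊤ C₀) where
    private
      module YZ = HomObj Y Z
      module XY = HomObj X Y
      module XZ = HomObj X Z
      module P = Product (products YZ.object XY.object)

      abstract
        dom-at : ∀ {T} (t : Hom T XY.object) → dom ∘ (XY.incl ∘ t) ≡ X ∘ !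
        dom-at t = sym (assoc _ _ _) ∙ (XY.dom-incl ⟩∘ t) ∙ assoc _ _ _ ∙ (X ∘⟨ !-unique _ _)

        cod-at : ∀ {T} (t : Hom T YZ.object) → cod ∘ (YZ.incl ∘ t) ≡ Z ∘ !
        cod-at t = sym (assoc _ _ _) ∙ (YZ.cod-incl ⟩∘ t) ∙ assoc _ _ _ ∙ (Z ∘⟨ !-unique _ _)

        composable : ∀ {T} (s : Hom T YZ.object) (t : Hom T XY.object) →
                     dom ∘ (YZ.incl ∘ s) ≡ cod ∘ (XY.incl ∘ t)
        composable s t =
            sym (assoc _ _ _) ∙ (YZ.dom-incl ⟩∘ s) ∙ assoc _ _ _ ∙ (Y ∘⟨ !-unique _ _)
          ∙ sym (assoc _ _ _) ∙ (sym XY.cod-incl ⟩∘ t) ∙ assoc _ _ _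

    hom-compose : Hom P.A×B XZ.object
    hom-compose = XZ.element
      (compose (YZ.incl ∘ P.π₁) (XY.incl ∘ P.π₂) (composable P.π₁ P.π₂))
      (dom-compose ∙ dom-at P.π₂) (cod-compose ∙ cod-at P.π₁)

    abstract
      -- `hom-compose` composes the two generic elements; composition is stable under
      -- precomposition, here with the pair of names, and `incl` is monic.
      hom-compose-name : (g : GlobalArrow Y Z) (f : GlobalArrow X Y) →
                         hom-compose ∘ P.⟨ name g , name f ⟩ ≡ name (Category._∘_ Γ g f)
      hom-compose-name g f = XZ.incl-mono _ _
        ( sym (assoc _ _ _) ∙ (XZ.incl∘element _ _ _ ⟩∘ _)
        ∙ compose-∘ _ {(dom ∘⟨ e₁) ∙ dom-arr g ∙ sym (cod-arr f) ∙ (cod ∘⟨ sym e₂)}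
        ∙ compose-cong e₁ e₂
        ∙ sym (incl∘name (Category._∘_ Γ g f)) )
        where
          e₁ : (YZ.incl ∘ P.π₁) ∘ P.⟨ name g , name f ⟩ ≡ arr g
          e₁ = assoc _ _ _ ∙ (YZ.incl ∘⟨ P.π₁∘⟨⟩ _ _) ∙ incl∘name g
          e₂ : (XY.incl ∘ P.π₂) ∘ P.⟨ name g , name f ⟩ ≡ arr f
          e₂ = assoc _ _ _ ∙ (XY.incl ∘⟨ P.π₂∘⟨⟩ _ _) ∙ incl∘name f

  module Over (X : Hom ⊤ C₀) = Pullback (pullback cod X)

  -- Extends `⌜over⌝` to arrows of `Γ` not given as images under `F`, such as the projections of the
  -- chosen pullbacks of `Γ`.
  slice-point : ∀ {W X} → GlobalArrow W X → Hom ⊤ (Over.P X)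
  slice-point {X = X} u = Over.universal X (arr u) id (cod-arr u ∙ sym (identityʳ _))

  slice-point-coe : ∀ {W W′ X} (p : W ≡ W′) {u : GlobalArrow W X} {v : GlobalArrow W′ X} →
                    u ≡ Category._∘_ Γ v (Category.coe Γ p) → slice-point u ≡ slice-point v
  slice-point-coe refl e = cong slice-point (e ∙ Category.identityʳ Γ _)

  module Reindexing (𝕃 : InternalFiniteLimits L ℂ) (X Y : Hom ⊤ C₀) where
    open InternalLimits L 𝕃 hiding (commute)
    private
      module XY = HomObj X Y
      module OX = Over X
      module OY = Over Y
      module P = Product (products OY.P XY.object)

      arrow-at : Hom P.A×B C₁
      arrow-at = XY.incl ∘ P.π₂

      object-at : Hom P.A×B C₁
      object-at = OY.p₁ ∘ P.π₁

      abstract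
        is-cospan : cod ∘ arrow-at ≡ cod ∘ object-at
        is-cospan =
            sym (assoc _ _ _) ∙ (XY.cod-incl ⟩∘ _) ∙ assoc _ _ _ ∙ (Y ∘⟨ !-unique _ _)
          ∙ sym (assoc _ _ _) ∙ (sym OY.commute ⟩∘ _) ∙ assoc _ _ _

        over-X : cod ∘ (π₁ ∘ cs is-cospan) ≡ X ∘ !
        over-X = cod-π₁-at is-cospan ∙ sym (assoc _ _ _) ∙ (XY.dom-incl ⟩∘ _)
               ∙ assoc _ _ _ ∙ (X ∘⟨ !-unique _ _)

    -- The arrow is the first leg of the cospan and the object the second, as in the `pullback f y`
    -- of `cod-fibration`; hence `π₁` is the reindexed object.
    over-pullback : Hom P.A×B OX.P
    over-pullback = OX.universal (π₁ ∘ cs is-cospan) ! over-X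

    abstract
      -- Pullbacks in `Γ` are computed by the same internal `π₁`, so it suffices that the generic
      -- cospan specialises to that of `f` and `y`.
      over-pullback-name : ∀ {W} (y : GlobalArrow W Y) (f : GlobalArrow X Y) →
        over-pullback ∘ P.⟨ slice-point y , name f ⟩ ≡
        slice-point (Pullback.p₁ (FiniteLimits.pullback ΓLimits f y))
      over-pullback-name y f = OX.unique _ _
        ( sym (assoc _ _ _) ∙ (OX.p₁∘universal _ _ over-X ⟩∘ _) ∙ assoc _ _ _
        ∙ (π₁ ∘⟨ cospan-eq)
        ∙ sym (OX.p₁∘universal _ _ _) )
        (!-unique _ _)
        where
          r : cod ∘ arr f ≡ cod ∘ arr y
          r = cod-arr f ∙ sym (cod-arr y)
          cospan-eq : cs is-cospan ∘ P.⟨ slice-point y , name f ⟩ ≡ cs r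
          cospan-eq = Cospan.unique _ _
            ( sym (assoc _ _ _) ∙ (Cospan.p₁∘universal _ _ is-cospan ⟩∘ _) ∙ assoc _ _ _
            ∙ (XY.incl ∘⟨ P.π₂∘⟨⟩ _ _) ∙ incl∘name f ∙ sym (Cospan.p₁∘universal _ _ r) )
            ( sym (assoc _ _ _) ∙ (Cospan.p₂∘universal _ _ is-cospan ⟩∘ _) ∙ assoc _ _ _
            ∙ (OY.p₁ ∘⟨ P.π₁∘⟨⟩ _ _) ∙ OY.p₁∘universal _ _ _
            ∙ sym (Cospan.p₂∘universal _ _ r) )

-- Self-coding by means of `ℍ`.

module _ (𝒢 : PreGeminal o ℓ) where
  open PreGeminal 𝒢
  open Category ℬ
  open FiniteLimits limits
  open Internal limits ℂ
  open GlobalArrow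
  open InternalLimits limits ℂ-limits using (one; ΓLimits)
  open StrictlyPreservesFiniteLimits F-strict using (strict-⊤; strict-pb)
  open Box limits ℂ-limits F F-strict
  open InternalFunctor ℍ using (H₀; H₁) renaming (dom to H-dom; cod to H-cod)
  private
    module F = Functor F
    module □ = Functor □
    module □⊤ = IsTerminal (PreservesFiniteLimits.preserves-⊤ □-preserves)

  open □ℂ using (ι)

  abstract
    slice-point-pullback : ∀ {A B X} (y : Hom X B) (f : Hom A B) →
      slice-point limits ℂ (Pullback.p₁ (FiniteLimits.pullback ΓLimits (F.F₁ f) (F.F₁ y))) ≡
      slice-point limits ℂ (F.F₁ (Pullback.p₁ (pullback f y)))
    slice-point-pullback y f =
      sym (slice-point-coe limits ℂ (proj₁ (strict-pb f y)) (proj₁ (proj₂ (strict-pb f y))))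

    -- The name of `Fℂ.ι` is a point of the terminal object `□⊤`, hence equals `ι`. This rewrites
    -- `ℍ-F` in terms of `□`.
    name-∘ι : ∀ {S} (a : Hom ⊤ S) → name (Category._∘_ Γ (F.F₁ a) Fℂ.ι) ≡ □.F₁ a ∘ ι
    name-∘ι a = sym (γ₁∘name (F.F₁ a) Fℂ.ι) ∙ (_ ∘⟨ □⊤.!-unique _ _)

    H₀-F : ∀ A → H₀ ∘ F.F₀ A ≡ □.F₁ (F.F₀ A) ∘ ι
    H₀-F A = _≡F_.eq₀ ℍ-F A ∙ name-∘ι (F.F₀ A)

    H₁-F : ∀ {A B} (f : Hom A B) → H₁ ∘ arr (F.F₁ f) ≡ □.F₁ (arr (F.F₁ f)) ∘ ι
    H₁-F f = ≡F⇒arr-≡ limits □ℂ.image ℍ-F f ∙ name-∘ι (arr (F.F₁ f))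

    -- With `δ` either `dom` or `cod`, this supplies the cone condition for restricting `H₁` to an
    -- object of codes.
    H₁-at : ∀ {T} {δ : Hom C₁ C₀} {A} (h : Hom T C₁) → □.F₁ δ ∘ H₁ ≡ H₀ ∘ δ →
            δ ∘ h ≡ F.F₀ A ∘ ! → □.F₁ δ ∘ (H₁ ∘ h) ≡ □.F₁ (F.F₀ A) ∘ (ι ∘ !)
    H₁-at {A = A} h H-δ e =
        sym (assoc _ _ _) ∙ (H-δ ⟩∘ h) ∙ assoc _ _ _ ∙ (H₀ ∘⟨ e)
      ∙ sym (assoc _ _ _) ∙ (H₀-F A ⟩∘ !) ∙ assoc _ _ _

  -- □S = ℂ(1 , FS), while codes of morphisms ⊤ → S live in ℂ(F⊤ , FS).
  to-⌜Hom⌝ : ∀ S → Hom (□.F₀ S) (⌜Hom⌝ 𝒢 ⊤ S)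
  to-⌜Hom⌝ S = coe (cong (λ X → HomObj.object X (F.F₀ S))
                      (sym strict-⊤))

  abstract
    -- `X` is kept variable so that `e` can be matched, which `strict-⊤` does not allow; then `w` is
    -- an endomorphism of the terminal object, hence the identity.
    coe-name : ∀ {X Y} (e : X ≡ one) (u : GlobalArrow X Y) (w : GlobalArrow one X) →
               coe (cong (λ X → HomObj.object X Y) (sym e)) ∘ name (Category._∘_ Γ u w) ≡ name u
    coe-name refl u w = identityˡ _ ∙ cong name
      ( cong (Category._∘_ Γ u) (IsTerminal.!-unique (FiniteLimits.isTerminal ΓLimits) _ _)
      ∙ Category.identityʳ Γ u )

    to-⌜Hom⌝-ι : ∀ {S} (a : Hom ⊤ S) → to-⌜Hom⌝ S ∘ (□.F₁ a ∘ ι) ≡ ⌜hom⌝ 𝒢 a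
    to-⌜Hom⌝-ι a = (_ ∘⟨ sym (name-∘ι a)) ∙ coe-name strict-⊤ (F.F₁ a) Fℂ.ι

  module SelfCoding {Z} (f : Hom C₁ Z) (z : Hom ⊤ Z)
    (e : □.F₁ f ∘ (H₁ ∘ Pullback.p₁ (pullback f z)) ≡ □.F₁ z ∘ (ι ∘ !)) where
    private
      module S = Pullback (pullback f z)
      module □S = IsPullback (PreservesFiniteLimits.preserves-pb □-preserves f z)

      restrict : Hom S.P (□.F₀ S.P)
      restrict = □S.universal (H₁ ∘ S.p₁) (ι ∘ !) e

    self-code : Hom S.P (⌜Hom⌝ 𝒢 ⊤ S.P)
    self-code = to-⌜Hom⌝ S.P ∘ restrict

    abstract
      self-code-∘ : ∀ {A B} (x : Hom A B) (s : Hom ⊤ S.P) → S.p₁ ∘ s ≡ arr (F.F₁ x) →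
                    self-code ∘ s ≡ ⌜hom⌝ 𝒢 s
      self-code-∘ x s p = assoc _ _ _ ∙ (to-⌜Hom⌝ S.P ∘⟨ restrict-∘) ∙ to-⌜Hom⌝-ι s
        where
          restrict-∘ : restrict ∘ s ≡ □.F₁ s ∘ ι
          -- On the first leg this is `H₁-F` at `x`; the second leg lands in the terminal object
          -- `□⊤`.
          restrict-∘ = □S.unique _ _
            ( sym (assoc _ _ _) ∙ (□S.p₁∘universal _ _ e ⟩∘ s) ∙ assoc _ _ _
            ∙ (H₁ ∘⟨ p) ∙ H₁-F x ∙ (cong □.F₁ (sym p) ⟩∘ ι)
            ∙ (□.homomorphism _ _ ⟩∘ ι) ∙ assoc _ _ _ )
            (□⊤.!-unique _ _)

  module HomSelfCoding (A D : Obj) where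
    private
      module O = HomObj (F.F₀ A) (F.F₀ D)

      □-triangle : ∀ {T X Y Z} {g : Hom Y Z} {f : Hom X Y} {h : Hom X Z} (t : Hom T (□.F₀ X)) →
                   g ∘ f ≡ h → □.F₁ g ∘ (□.F₁ f ∘ t) ≡ □.F₁ h ∘ t
      □-triangle t refl = sym (assoc _ _ _) ∙ (sym (□.homomorphism _ _) ⟩∘ t)

      abstract
        commutes : □.F₁ ⟨dom,cod⟩.⟨ dom , cod ⟩ ∘ (H₁ ∘ O.incl) ≡
                   □.F₁ ⟨dom,cod⟩.⟨ F.F₀ A , F.F₀ D ⟩ ∘ (ι ∘ !)
        -- The equation lands in the image under `□` of the product of `C₀` with itself, so it is
        -- tested on the two projections.
        commutes = preserves-product-monic □-preserves C₀ C₀ _ _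
          ( □-triangle _ (⟨dom,cod⟩.π₁∘⟨⟩ _ _) ∙ H₁-at O.incl H-dom O.dom-incl
          ∙ sym (□-triangle _ (⟨dom,cod⟩.π₁∘⟨⟩ _ _)) )
          ( □-triangle _ (⟨dom,cod⟩.π₂∘⟨⟩ _ _) ∙ H₁-at O.incl H-cod O.cod-incl
          ∙ sym (□-triangle _ (⟨dom,cod⟩.π₂∘⟨⟩ _ _)) )

    open SelfCoding ⟨dom,cod⟩.⟨ dom , cod ⟩ ⟨dom,cod⟩.⟨ F.F₀ A , F.F₀ D ⟩ commutes public

  module OverSelfCoding (A : Obj) where
    private
      module O = Over limits ℂ (F.F₀ A)

      abstract
        commutes : □.F₁ cod ∘ (H₁ ∘ O.p₁) ≡ □.F₁ (F.F₀ A) ∘ (ι ∘ !)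
        commutes = H₁-at O.p₁ H-cod (O.commute ∙ (_ ∘⟨ !-unique _ _))

    open SelfCoding cod (F.F₀ A) commutes public

  -- Assembly of the two code structures.

  dom-code-structure : ∀ D → CodeStructure terminal products (dom-fibration ℬ D)
  dom-code-structure D = record
    { codes  = dom-codes 𝒢 D
    ; app    = λ A B → HomComposition.hom-compose limits ℂ (F.F₀ A) (F.F₀ B) (F.F₀ D)
    -- Matching the base equality lets the code and the cleavage compute: the reindexed object
    -- becomes `x ∘ f`.
    ; app-≈  = λ { (slice x over refl) f → ≡⇒≈ terminal products (dom-fibration ℬ D)
                   ( HomComposition.hom-compose-name limits ℂ _ _ _ (F.F₁ x) (F.F₁ f)
                   ∙ cong name (sym (F.homomorphism x f)) ) }
    ; code   = λ A → HomSelfCoding.self-code A D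
    ; code-≈ = λ { (slice x over refl) → ≡⇒≈ terminal products (dom-fibration ℬ D)
                   (HomSelfCoding.self-code-∘ _ D x _ (incl∘name (F.F₁ x))) }
    }

  cod-code-structure : CodeStructure terminal products (cod-fibration ℬ limits)
  cod-code-structure = record
    { codes  = cod-codes 𝒢
    ; app    = λ A B → Reindexing.over-pullback limits ℂ ℂ-limits (F.F₀ A) (F.F₀ B)
    ; app-≈  = λ { (arrow x over refl) f → ≡⇒≈ terminal products (cod-fibration ℬ limits)
                   ( Reindexing.over-pullback-name limits ℂ ℂ-limits _ _ (F.F₁ x) (F.F₁ f)
                   ∙ slice-point-pullback x f ) }
    ; code   = OverSelfCoding.self-code
    ; code-≈ = λ { (arrow x over refl) → ≡⇒≈ terminal products (cod-fibration ℬ limits)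
                   (OverSelfCoding.self-code-∘ _ x _ (Over.p₁∘universal limits ℂ _ _ _ _)) }
    }

theorem4p17 : ∀ {o ℓ} (𝒢 : PreGeminal o ℓ) →
    let open PreGeminal 𝒢
        open FiniteLimits limits
    in (∀ D → Σ[ S ∈ CodeStructure terminal products (dom-fibration ℬ D) ]
                CodeStructure.codes S ≡ dom-codes 𝒢 D)
       × (Σ[ S ∈ CodeStructure terminal products (cod-fibration ℬ limits) ]
                CodeStructure.codes S ≡ cod-codes 𝒢)
theorem4p17 𝒢 = (λ D → dom-code-structure 𝒢 D , refl) , (cod-code-structure 𝒢 , refl)
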